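{- Let $G$ be a metric group of odd order $N=|G|$ and let $E\colon G\to\overline{\mathbb{Q}}$ be a finite quantum dilogarithm on $G$. Then $E(u)$ is a $2$-adic unit for every $u\in G$, i.e. $v(E(u))=0$ for every valuation $v$ of $\overline{\mathbb{Q}}$ extending the $2$-adic valuation of $\mathbb{Q}$.
   Context: Here $\overline{\mathbb{Q}}\subset\mathbb{C}$. A metric group is a finite abelian group $G$ together with a function $\langle\cdot\rangle\colon G\to\mathbb{C}^\times$ such that $\langle x\rangle=\langle -x\rangle$ for all $x$ and $\langle x;y\rangle:=\dfrac{\langle x+y\rangle}{\langle x\rangle\langle y\rangle}$ is a non-degenerate bicharacter on $G$. A finite quantum dilogarithm for a metric group $G$, $N=|G|$, is a function $E$ on $G$ such that for some non-zero constant $C$ and all $x,y\in G$, $$\langle x;y\rangle E(x)E(y)=C+\frac1{\sqrt N}\sum_{z\in G}E(y-z)E(z)\langle z\rangle E(x-z),$$ and which, when $|G|\le4$, is in addition required to satisfy $E(0)^2=\sqrt{N}\,E(0)+1$. -}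

module Defs where

open import Level using (_⊔_; suc)
open import Algebra.Apartness.Bundles using (HeytingField)
open import Algebra.Bundles using (AbelianGroup; CommutativeRing)
import Algebra.Consequences.Setoid as SetoidConsequences
import Algebra.Construct.DirectProduct as DirectProduct
import Algebra.Definitions.RawMonoid as RawMonoidDefinitions
open import Algebra.Morphism.Structures using (module RingMorphisms)
import Algebra.Properties.Ring as RingProperties
import Algebra.Solver.Ring.NaturalCoefficients.Default as SemiringSolver
open import Data.Fin.Base using (Fin)
open import Data.Integer.Base as ℤ using (ℤ; +_; -[1+_]; 0ℤ)
import Data.Integer.Divisibility as ℤ
open import Data.List.Base using (List; []; _∷_; foldr)
open import Data.List.Relation.Unary.Any using (Any)
open import Data.Nat.Base as ℕ using (ℕ)
open import Data.Product.Base using (_×_; _,_; proj₁; ∃-syntax)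
open import Data.Sum.Base using (_⊎_; inj₁)
open import Function.Base using (_∘_)
open import Function.Bundles using (_⇔_; Equivalence; Inverse)
open import Relation.Binary.Core using (Rel)
open import Relation.Binary.Structures using (IsStrictPartialOrder; IsDecTotalOrder)
import Relation.Binary.Construct.Add.Supremum.Equality as AddSupremumEquality
import Relation.Binary.Construct.Add.Supremum.NonStrict as AddSupremumOrder
open import Relation.Binary.PropositionalEquality using (_≢_)
import Relation.Binary.PropositionalEquality.Properties as ≡
import Relation.Binary.Reasoning.Setoid as SetoidReasoning
open import Relation.Nullary.Construct.Add.Supremum using (_⁺; ⊤⁺; [_])
open import Relation.Nullary.Negation using (¬_)

------------------------------------------------------------------------
-- Real and complex numbers

-- ℝ, characterised up to isomorphism as the Archimedean Cauchy-complete
-- ordered field.  The axioms are those satisfied by the constructive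
-- Cauchy reals; classically _#_ is _≉_ and they are the usual ones.
record RealNumbers c ℓ₁ ℓ₂ : Set (suc (c ⊔ ℓ₁ ⊔ ℓ₂)) where
  field
    heytingField : HeytingField c ℓ₁ ℓ₂

  open HeytingField heytingField public

  commutativeRing : CommutativeRing c ℓ₁
  commutativeRing = record { isCommutativeRing = isCommutativeRing }

  open RawMonoidDefinitions (CommutativeRing.+-rawMonoid commutativeRing) public
    using () renaming (_×_ to _·_)

  infix 4 _<_
  field
    _<_                  : Rel Carrier ℓ₂
    isStrictPartialOrder : IsStrictPartialOrder _≈_ _<_
    #⇔<⊎>                : ∀ {x y} → x # y ⇔ (x < y ⊎ y < x)
    +-monoˡ-<            : ∀ {x y} z → x < y → x + z < y + z
    *-pos                : ∀ {x y} → 0# < x → 0# < y → 0# < x * y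
    archimedean          : ∀ x → ∃[ n ] x < n · 1#
    complete             : (f : ℕ → Carrier) →
      (∀ ε → 0# < ε → ∃[ k ] ∀ m n → k ℕ.≤ m → k ℕ.≤ n → f m < f n + ε) →
      ∃[ l ] ∀ ε → 0# < ε → ∃[ k ] ∀ n → k ℕ.≤ n → f n < l + ε × l < f n + ε

-- The positive square root √n, which is unique.
record SquareRoot {c ℓ₁ ℓ₂} (ℝ : RealNumbers c ℓ₁ ℓ₂) (n : ℕ) : Set (c ⊔ ℓ₁ ⊔ ℓ₂) where
  open RealNumbers ℝ
  field
    root     : Carrier
    positive : 0# < root
    squared  : root * root ≈ n · 1#

  0#root : 0# # root
  0#root = Equivalence.from #⇔<⊎> (inj₁ positive)

  -- #⇒invertible inverts the difference of apart elements: this is −(0 − √n)⁻¹.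
  root⁻¹ : Carrier
  root⁻¹ = - proj₁ (#⇒invertible 0#root)

private
  -- Identities for complex multiplication, with −x written as j x for
  -- j = −1 so that they reduce to identities of commutative semirings.
  module ComplexLaws {c ℓ} (R : CommutativeRing c ℓ) where
    open CommutativeRing R
    open RingProperties ring using (-1*x≈-x; -0#≈0#)
    open SemiringSolver commutativeSemiring using (solve; _:=_; _:+_; _:*_)

    j : Carrier
    j = - 1#

    -≈j* : ∀ x → - x ≈ j * x
    -≈j* x = sym (-1*x≈-x x)

    sub : ∀ x y → x - y ≈ x + j * y
    sub x y = +-congˡ (-≈j* y)

    *-assocʳᵉ : ∀ a b c d e f →
      (a * c - b * d) * e - (a * d + b * c) * f ≈
      a * (c * e - d * f) - b * (c * f + d * e)
    *-assocʳᵉ a b c d e f = begin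
      (a * c - b * d) * e - (a * d + b * c) * f
        ≈⟨ trans (sub _ _) (+-congʳ (*-congʳ (sub _ _))) ⟩
      (a * c + j * (b * d)) * e + j * ((a * d + b * c) * f)
        ≈⟨ solve 7 (λ a b c d e f j →
             (a :* c :+ j :* (b :* d)) :* e :+ j :* ((a :* d :+ b :* c) :* f) :=
             a :* (c :* e :+ j :* (d :* f)) :+ j :* (b :* (c :* f :+ d :* e)))
             refl a b c d e f j ⟩
      a * (c * e + j * (d * f)) + j * (b * (c * f + d * e))
        ≈⟨ trans (sub _ _) (+-congʳ (*-congˡ (sub _ _))) ⟨
      a * (c * e - d * f) - b * (c * f + d * e) ∎
      where open SetoidReasoning setoid

    *-assocⁱᵐ : ∀ a b c d e f →
      (a * c - b * d) * f + (a * d + b * c) * e ≈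
      a * (c * f + d * e) + b * (c * e - d * f)
    *-assocⁱᵐ a b c d e f = begin
      (a * c - b * d) * f + (a * d + b * c) * e
        ≈⟨ +-congʳ (*-congʳ (sub _ _)) ⟩
      (a * c + j * (b * d)) * f + (a * d + b * c) * e
        ≈⟨ solve 7 (λ a b c d e f j →
             (a :* c :+ j :* (b :* d)) :* f :+ (a :* d :+ b :* c) :* e :=
             a :* (c :* f :+ d :* e) :+ b :* (c :* e :+ j :* (d :* f)))
             refl a b c d e f j ⟩
      a * (c * f + d * e) + b * (c * e + j * (d * f))
        ≈⟨ +-congˡ (*-congˡ (sub _ _)) ⟨
      a * (c * f + d * e) + b * (c * e - d * f) ∎
      where open SetoidReasoning setoid

    *-commʳᵉ : ∀ a b c d → a * c - b * d ≈ c * a - d * b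
    *-commʳᵉ a b c d = +-cong (*-comm a c) (-‿cong (*-comm b d))

    *-commⁱᵐ : ∀ a b c d → a * d + b * c ≈ c * b + d * a
    *-commⁱᵐ a b c d = trans (+-comm _ _) (+-cong (*-comm b c) (*-comm a d))

    *-identityˡʳᵉ : ∀ a b → 1# * a - 0# * b ≈ a
    *-identityˡʳᵉ a b = trans
      (+-cong (*-identityˡ a) (trans (-‿cong (zeroˡ b)) -0#≈0#)) (+-identityʳ a)

    *-identityˡⁱᵐ : ∀ a b → 1# * b + 0# * a ≈ b
    *-identityˡⁱᵐ a b = trans (+-cong (*-identityˡ b) (zeroˡ a)) (+-identityʳ b)

    distribˡʳᵉ : ∀ a b c d e f →
      a * (c + e) - b * (d + f) ≈ (a * c - b * d) + (a * e - b * f)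
    distribˡʳᵉ a b c d e f = begin
      a * (c + e) - b * (d + f)
        ≈⟨ sub _ _ ⟩
      a * (c + e) + j * (b * (d + f))
        ≈⟨ solve 7 (λ a b c d e f j →
             a :* (c :+ e) :+ j :* (b :* (d :+ f)) :=
             (a :* c :+ j :* (b :* d)) :+ (a :* e :+ j :* (b :* f)))
             refl a b c d e f j ⟩
      (a * c + j * (b * d)) + (a * e + j * (b * f))
        ≈⟨ +-cong (sub _ _) (sub _ _) ⟨
      (a * c - b * d) + (a * e - b * f) ∎
      where open SetoidReasoning setoid

    distribˡⁱᵐ : ∀ a b c d e f →
      a * (d + f) + b * (c + e) ≈ (a * d + b * c) + (a * f + b * e)
    distribˡⁱᵐ = solve 6 (λ a b c d e f →
      a :* (d :+ f) :+ b :* (c :+ e) := (a :* d :+ b :* c) :+ (a :* f :+ b :* e)) refl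

-- ℂ = ℝ × ℝ, the pair (a , b) being a + bi.
complexNumbers : ∀ {c ℓ₁ ℓ₂} → RealNumbers c ℓ₁ ℓ₂ → CommutativeRing c ℓ₁
complexNumbers ℝ = record
  { _*_ = mul
  ; 1#  = 1# , 0#
  ; isCommutativeRing = record
    { isRing = record
      { +-isAbelianGroup = A.isAbelianGroup
      ; *-cong     = λ (p , q) (r , s) →
          +-cong (*-cong p r) (-‿cong (*-cong q s)) , +-cong (*-cong p s) (*-cong q r)
      ; *-assoc    = λ (a , b) (c , d) (e , f) →
          *-assocʳᵉ a b c d e f , *-assocⁱᵐ a b c d e f
      ; *-identity = comm∧idˡ⇒id mul-comm λ (a , b) → *-identityˡʳᵉ a b , *-identityˡⁱᵐ a b
      ; distrib    = comm∧distrˡ⇒distr A.∙-cong mul-comm λ (a , b) (c , d) (e , f) →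
          distribˡʳᵉ a b c d e f , distribˡⁱᵐ a b c d e f
      }
    ; *-comm = mul-comm
    }
  }
  where
  open CommutativeRing (RealNumbers.commutativeRing ℝ)
  open ComplexLaws (RealNumbers.commutativeRing ℝ)
  module A = AbelianGroup (DirectProduct.abelianGroup +-abelianGroup +-abelianGroup)
  open SetoidConsequences A.setoid using (comm∧idˡ⇒id; comm∧distrˡ⇒distr)

  mul : A.Carrier → A.Carrier → A.Carrier
  mul (a , b) (c , d) = a * c - b * d , a * d + b * c

  mul-comm : ∀ x y → mul x y A.≈ mul y x
  mul-comm (a , b) (c , d) = *-commʳᵉ a b c d , *-commⁱᵐ a b c d

------------------------------------------------------------------------
-- Algebraic numbers

module _ {c ℓ} (R : CommutativeRing c ℓ) where
  open CommutativeRing R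
  open RawMonoidDefinitions +-rawMonoid using () renaming (_×_ to _·_)

  fromℤ : ℤ → Carrier
  fromℤ (+ n)    = n · 1#
  fromℤ -[1+ n ] = - (ℕ.suc n · 1#)

  -- Coefficients are listed from the constant term upwards.
  evaluate : List ℤ → Carrier → Carrier
  evaluate p x = foldr (λ a r → fromℤ a + x * r) 0# p

  Algebraic : Carrier → Set ℓ
  Algebraic x = ∃[ p ] Any (_≢ 0ℤ) p × evaluate p x ≈ 0#

-- ℚ̄ ⊂ ℂ: a field with an embedding in ℂ whose image consists of exactly
-- the algebraic numbers.
record AlgebraicNumbers {c ℓ₁ ℓ₂} (ℝ : RealNumbers c ℓ₁ ℓ₂) d ℓ :
                        Set (suc (c ⊔ ℓ₁ ⊔ d ⊔ ℓ)) where
  private module ℂ = CommutativeRing (complexNumbers ℝ)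
  field
    commutativeRing : CommutativeRing d ℓ

  open CommutativeRing commutativeRing public

  field
    inverse      : ∀ x → x ≉ 0# → ∃[ y ] x * y ≈ 1#
    embed        : Carrier → ℂ.Carrier
    monomorphism : RingMorphisms.IsRingMonomorphism rawRing ℂ.rawRing embed
    algebraic    : ∀ x → Algebraic (complexNumbers ℝ) (embed x)
    surjective   : ∀ z → Algebraic (complexNumbers ℝ) z → ∃[ x ] embed x ℂ.≈ z

------------------------------------------------------------------------
-- Valuations

record OrderedAbelianGroup c ℓ₁ ℓ₂ : Set (suc (c ⊔ ℓ₁ ⊔ ℓ₂)) where
  field
    abelianGroup : AbelianGroup c ℓ₁

  open AbelianGroup abelianGroup public

  infix 4 _≤_
  field
    _≤_             : Rel Carrier ℓ₂
    isDecTotalOrder : IsDecTotalOrder _≈_ _≤_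
    ∙-monoˡ-≤       : ∀ {x y} z → x ≤ y → x ∙ z ≤ y ∙ z

  open AddSupremumEquality _≈_ public using (_≈⁺_)
  open AddSupremumOrder _≤_ public using (_≤⁺_)
  open RawMonoidDefinitions rawMonoid public using () renaming (_×_ to _·_)

  infixl 7 _∙⁺_
  _∙⁺_ : Carrier ⁺ → Carrier ⁺ → Carrier ⁺
  [ x ] ∙⁺ [ y ] = [ x ∙ y ]
  [ _ ] ∙⁺ ⊤⁺    = ⊤⁺
  ⊤⁺    ∙⁺ _     = ⊤⁺

record Valuation {c ℓ g ℓ₁ ℓ₂} (K : CommutativeRing c ℓ)
                 (Γ : OrderedAbelianGroup g ℓ₁ ℓ₂) : Set (c ⊔ ℓ ⊔ g ⊔ ℓ₁ ⊔ ℓ₂) where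
  private
    module K = CommutativeRing K
    module Γ = OrderedAbelianGroup Γ
  field
    v      : K.Carrier → Γ.Carrier ⁺
    v-cong : ∀ {x y} → x K.≈ y → v x Γ.≈⁺ v y
    v-∞    : ∀ x → v x Γ.≈⁺ ⊤⁺ ⇔ x K.≈ K.0#
    v-*    : ∀ x y → v (x K.* y) Γ.≈⁺ v x Γ.∙⁺ v y
    -- v (x + y) ≥ min (v x) (v y), as Γ is totally ordered
    v-+    : ∀ x y → v x Γ.≤⁺ v (x K.+ y) ⊎ v y Γ.≤⁺ v (x K.+ y)

Oddℤ : ℤ → Set
Oddℤ n = ¬ (+ 2 ℤ.∣ n)

-- The value group contains ℤ as the multiples of a positive element 1Γ,
-- and v (2ᵃm / 2ᵇn) = a − b for all odd integers m and n.
record ExtendsTwoAdic {c ℓ g ℓ₁ ℓ₂} {K : CommutativeRing c ℓ} {Γ : OrderedAbelianGroup g ℓ₁ ℓ₂}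
                      (V : Valuation K Γ) : Set (c ⊔ ℓ ⊔ g ⊔ ℓ₁ ⊔ ℓ₂) where
  open CommutativeRing K using (_*_) renaming (_≈_ to _≈K_)
  open OrderedAbelianGroup Γ
  open Valuation V
  field
    1Γ         : Carrier
    1Γ-nonneg  : ε ≤ 1Γ
    1Γ-nonzero : 1Γ ≉ ε
    v-ratio    : ∀ a b m n → Oddℤ m → Oddℤ n → ∀ q →
      fromℤ K (+ (2 ℕ.^ b) ℤ.* n) * q ≈K fromℤ K (+ (2 ℕ.^ a) ℤ.* m) →
      v q ≈⁺ [ (a · 1Γ) ∙ (b · 1Γ) ⁻¹ ]

------------------------------------------------------------------------
-- Metric groups and finite quantum dilogarithms

record UnitOf {c ℓ} (R : CommutativeRing c ℓ) : Set (c ⊔ ℓ) where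
  open CommutativeRing R
  field
    value     : Carrier
    value⁻¹   : Carrier
    isInverse : value * value⁻¹ ≈ 1#

-- G is written multiplicatively, following AbelianGroup: _∙_ is x + y,
-- _⁻¹ is −x and ε is 0.
record MetricGroup {c ℓ₁ ℓ₂} (ℝ : RealNumbers c ℓ₁ ℓ₂) g ℓ :
                   Set (suc (c ⊔ ℓ₁ ⊔ g ⊔ ℓ)) where
  private module ℂ = CommutativeRing (complexNumbers ℝ)
  field
    abelianGroup : AbelianGroup g ℓ

  open AbelianGroup abelianGroup public

  field
    order       : ℕ
    enumeration : Inverse (≡.setoid (Fin order)) setoid
    unit        : Carrier → UnitOf (complexNumbers ℝ)

  ⟨_⟩ : Carrier → ℂ.Carrier
  ⟨ x ⟩ = UnitOf.value (unit x)

  ⟨_⟩⁻¹ : Carrier → ℂ.Carrier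
  ⟨ x ⟩⁻¹ = UnitOf.value⁻¹ (unit x)

  ⟨_⨾_⟩ : Carrier → Carrier → ℂ.Carrier
  ⟨ x ⨾ y ⟩ = ⟨ x ∙ y ⟩ ℂ.* (⟨ x ⟩⁻¹ ℂ.* ⟨ y ⟩⁻¹)

  -- The last three fields say that ⟨_⨾_⟩ is a non-degenerate bicharacter;
  -- it is symmetric, so non-degeneracy on one side suffices.
  field
    ⟨⟩-cong       : ∀ {x y} → x ≈ y → ⟨ x ⟩ ℂ.≈ ⟨ y ⟩
    ⟨⟩-even       : ∀ x → ⟨ x ⟩ ℂ.≈ ⟨ x ⁻¹ ⟩
    ⟨⨾⟩-homoˡ     : ∀ x y z → ⟨ x ∙ y ⨾ z ⟩ ℂ.≈ ⟨ x ⨾ z ⟩ ℂ.* ⟨ y ⨾ z ⟩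
    ⟨⨾⟩-homoʳ     : ∀ x y z → ⟨ x ⨾ y ∙ z ⟩ ℂ.≈ ⟨ x ⨾ y ⟩ ℂ.* ⟨ x ⨾ z ⟩
    nondegenerate : ∀ x → (∀ y → ⟨ x ⨾ y ⟩ ℂ.≈ ℂ.1#) → x ≈ ε

  open RawMonoidDefinitions ℂ.+-rawMonoid using (sum)

  ∑ : (Carrier → ℂ.Carrier) → ℂ.Carrier
  ∑ f = sum (f ∘ Inverse.to enumeration)

record IsFiniteQuantumDilogarithm
         {c ℓ₁ ℓ₂ g ℓ} {ℝ : RealNumbers c ℓ₁ ℓ₂} (G : MetricGroup ℝ g ℓ)
         (√N : SquareRoot ℝ (MetricGroup.order G))
         (E : MetricGroup.Carrier G → CommutativeRing.Carrier (complexNumbers ℝ)) :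
         Set (c ⊔ ℓ₁ ⊔ g ⊔ ℓ) where
  open CommutativeRing (complexNumbers ℝ)
    using (_+_; _*_; 0#; 1#) renaming (Carrier to ℂ; _≈_ to _≈ℂ_; _≉_ to _≉ℂ_)
  open MetricGroup G
  open SquareRoot √N

  real : RealNumbers.Carrier ℝ → ℂ
  real a = a , RealNumbers.0# ℝ

  field
    E-cong : ∀ {x y} → x ≈ y → E x ≈ℂ E y
    dilogarithm : ∃[ C ] C ≉ℂ 0# × (∀ x y →
      ⟨ x ⨾ y ⟩ * E x * E y ≈ℂ
      C + real root⁻¹ * ∑ (λ z → E (y ∙ z ⁻¹) * E z * ⟨ z ⟩ * E (x ∙ z ⁻¹)))
    small-order : order ℕ.≤ 4 → E ε * E ε ≈ℂ real root * E ε + 1#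

{-# OPTIONS --safe #-}

-- Write a for ⟨_⟩, b for ⟨_⨾_⟩, s = √N and f = a E, and let F be the Fourier transform
-- F(α) = Σ_x b(x,α) E(x).  Transforming the defining equation in x gives
--   s a(α) E(y) F(α+y) = s C a(α) Σ_x b(x,α) + F(α) H(y,α),
--   H(y,t) = Σ_z E(y−z) E(z) a(z+t) = H(y,−y−t).
-- Since a zero of E away from 0 would force C = 0, eliminating H yields F(−y) = κ f(y) and
-- E(y) E(−y) a(y) = p for y ≠ 0, with constants κ and p, and E(0)² = p + s E(0).  Then p = 1:
-- otherwise a would be constant on G ∖ {0}, which is impossible for N > 3, and for N ≤ 4 it
-- follows from the extra requirement.  As N is odd, the involution z ↦ 2u−z fixes only u, so
-- with t = −u and y = 2u the equation becomes s E(2u) = E(u)² (E(u)² + 2X), where X is a sum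
-- of terms E(u−w) E(u+w) a(w).  Taking E(u) of minimal valuation shows that all E(u) are
-- integral, hence units by E(u) E(−u) a(u) = 1 and E(0) (E(0) − s) = 1.

module Submission where

open import Algebra.Bundles using (AbelianGroup; CommutativeMonoid; CommutativeRing)
import Algebra.Definitions.RawMonoid as RawMonoidDefinitions
open import Algebra.Morphism.Structures using (module RingMorphisms)
import Algebra.Properties.AbelianGroup as AbelianGroupProperties
import Algebra.Properties.CommutativeMonoid.Sum as Sum
import Algebra.Properties.CommutativeSemiring.Exp as Exponentiation
import Algebra.Properties.Ring as RingProperties
import Algebra.Properties.Semiring.Sum as SemiringSum
import Algebra.Solver.Ring.NaturalCoefficients.Default as SemiringSolver
open import Data.Empty using (⊥-elim)
open import Data.Fin.Base as Fin using (Fin; punchIn; zero; suc)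
open import Data.Fin.Patterns using (0F; 1F; 2F)
open import Data.Fin.Permutation using (Permutation)
import Data.Fin.Properties as Fin
open import Data.Integer.Base using (ℤ; +_; -[1+_]; 0ℤ)
open import Data.List.Base using (List; []; _∷_)
open import Data.List.Relation.Unary.Any using (here)
open import Data.Nat.Base as ℕ using (ℕ)
open import Data.Nat.Divisibility using (_∣_)
import Data.Nat.Divisibility as ℕ
import Data.Nat.Properties as ℕ
open import Data.Product.Base using (_×_; _,_; proj₁; proj₂; ∃-syntax)
open import Data.Sum.Base using (_⊎_; inj₁; inj₂)
open import Data.Vec.Functional using (Vector)
open import Defs
open import Function.Base using (_∘_; id)
open import Function.Bundles using (Inverse; Equivalence)
import Function.Construct.Composition as Composition
import Function.Construct.Symmetry as Symmetry
open import Level using (_⊔_)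
open import Relation.Binary.Bundles using (Setoid)
import Relation.Binary.Construct.Add.Supremum.Equality as AddSupremumEquality
import Relation.Binary.Construct.Add.Supremum.NonStrict as AddSupremumOrder
open import Relation.Binary.Definitions using (tri<; tri≈; tri>)
open import Relation.Binary.PropositionalEquality as ≡ using (_≡_; _≢_)
import Relation.Binary.Reasoning.Setoid as SetoidReasoning
open import Relation.Binary.Structures using (IsDecTotalOrder)
open import Relation.Nullary.Construct.Add.Supremum using (_⁺; ⊤⁺; [_])
open import Relation.Nullary.Decidable using (Dec; yes; no; map′; ¬?; _×-dec_)
open import Relation.Nullary.Negation using (¬_; contradiction)

-- Sums over a finite setoid

-- The argument divides by values of `E` and splits on whether they vanish. The constructive ℂ
-- supports neither, so the work is done in ℚ̄, where inverses are given and the valuation itself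
-- decides vanishing, because `v x ≈⁺ ⊤⁺` is decidable. The data descend: the values of the form are
-- 2N-th roots of unity, √N is algebraic, and √N C is a difference of two elements of ℚ̄.
--
-- The symmetry of H matters because it links different instances of one transformed equation: two
-- expressions for the same value of H give a relation free of H. For p = 1 the instance α = 0, the
-- only one in which C survives, is transformed once more. The result is linear in f(-β), with
-- coefficients independent of β, the decisive one being F(0) (κ E(0) - F(0)). If it is non-zero, f
-- is constant off 0, and then so is a, because p a(x) = f(x) f(-x). If it vanishes, the equation
-- collapses to p = 1. The bound N > 3 is sharp for the first alternative: on ℤ/3 the form ω^(x²),
-- with ω a primitive cube root of unity, is constant off 0.

module FiniteSetoid {a ℓ n} {S : Setoid a ℓ}
                    (enumeration : Inverse (≡.setoid (Fin n)) S) where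
  open Setoid S
  open Inverse enumeration

  infix 4 _≟_
  _≟_ : ∀ x y → Dec (x ≈ y)
  x ≟ y = map′ (λ eq → trans (sym (strictlyInverseˡ x)) (inverseˡ eq)) (λ eq → from-cong eq)
               (from x Fin.≟ from y)

  -- Pigeonhole: if every element were one of `u`, `v`, `w`, naming which one would inject `Fin n`
  -- into `Fin 3`. The three may coincide.
  avoid : 3 ℕ.< n → ∀ u v w → ∃[ x ] ¬ x ≈ u × ¬ x ≈ v × ¬ x ≈ w
  avoid 3<n u v w with Fin.any? (λ i → ¬? (to i ≟ u) ×-dec ¬? (to i ≟ v) ×-dec ¬? (to i ≟ w))
  ... | yes (i , distinct) = to i , distinct
  ... | no ¬distinct = contradiction (Fin.injective⇒≤ label-injective) (ℕ.<⇒≱ 3<n)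
    where
    cover : ∀ i → to i ≈ u ⊎ to i ≈ v ⊎ to i ≈ w
    cover i with to i ≟ u | to i ≟ v | to i ≟ w
    ... | yes p | _ | _ = inj₁ p
    ... | no _ | yes p | _ = inj₂ (inj₁ p)
    ... | no _ | no _ | yes p = inj₂ (inj₂ p)
    ... | no p | no q | no r = contradiction (i , p , q , r) ¬distinct

    class : ∀ {i} → to i ≈ u ⊎ to i ≈ v ⊎ to i ≈ w → Fin 3
    class (inj₁ _)        = 0F
    class (inj₂ (inj₁ _)) = 1F
    class (inj₂ (inj₂ _)) = 2F

    class-injective : ∀ {i j} (p : to i ≈ u ⊎ to i ≈ v ⊎ to i ≈ w)
      (q : to j ≈ u ⊎ to j ≈ v ⊎ to j ≈ w) → class {i} p ≡ class {j} q → to i ≈ to j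
    class-injective (inj₁ p)        (inj₁ q)        _ = trans p (sym q)
    class-injective (inj₁ _)        (inj₂ (inj₁ _)) ()
    class-injective (inj₁ _)        (inj₂ (inj₂ _)) ()
    class-injective (inj₂ (inj₁ _)) (inj₁ _)        ()
    class-injective (inj₂ (inj₂ _)) (inj₁ _)        ()
    class-injective (inj₂ (inj₁ p)) (inj₂ (inj₁ q)) _ = trans p (sym q)
    class-injective (inj₂ (inj₂ p)) (inj₂ (inj₂ q)) _ = trans p (sym q)

    label-injective : ∀ {i j} → class (cover i) ≡ class (cover j) → i ≡ j
    label-injective {i} {j} eq = ≡.trans (≡.sym (strictlyInverseʳ i))
      (≡.trans (from-cong (class-injective (cover i) (cover j) eq)) (strictlyInverseʳ j))

  module Summation {c ℓ′} (M : CommutativeMonoid c ℓ′) where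
    private module M = CommutativeMonoid M
    open Sum M using (sum; sum-cong-≋; sum-permute; sum-remove;
                      sum-replicate; sum-replicate-zero; ∑-distrib-+)
    open RawMonoidDefinitions M.rawMonoid using () renaming (_×_ to _·_)

    -- Opaque, so that summands can be inferred by unification.
    opaque
      ∑ : (Carrier → M.Carrier) → M.Carrier
      ∑ f = sum (f ∘ to)

      ∑-sum : ∀ f → ∑ f M.≈ sum (f ∘ to)
      ∑-sum f = M.refl

    private
      sum-single : ∀ {m} (f : Vector M.Carrier m) i →
                   (∀ j → j ≢ i → f j M.≈ M.ε) → sum f M.≈ f i
      sum-single {ℕ.suc m} f i f≈ε = M.trans (sum-remove f) (M.trans
        (M.∙-congˡ (M.trans (sum-cong-≋ λ j → f≈ε (punchIn i j) (Fin.punchInᵢ≢i i j))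
                            (sum-replicate-zero m)))
        (M.identityʳ _))

    opaque
      unfolding ∑

      ∑-cong : ∀ {f g} → (∀ x → f x M.≈ g x) → ∑ f M.≈ ∑ g
      ∑-cong f≈g = sum-cong-≋ (f≈g ∘ to)

      ∑-const : ∀ k → ∑ (λ _ → k) M.≈ n · k
      ∑-const k = sum-replicate n

      ∑-∙ : ∀ f g → ∑ (λ x → f x M.∙ g x) M.≈ ∑ f M.∙ ∑ g
      ∑-∙ f g = ∑-distrib-+ (f ∘ to) (g ∘ to)

      ∑-permute : ∀ f → (∀ {x y} → x ≈ y → f x M.≈ f y) →
                  (π : Inverse S S) → ∑ f M.≈ ∑ (f ∘ Inverse.to π)
      ∑-permute f f-cong π = M.trans
        (sum-permute (f ∘ to) σ)
        (sum-cong-≋ λ i → f-cong (strictlyInverseˡ (Inverse.to π (to i))))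
        where
        -- `π` conjugated by the enumeration.
        σ : Permutation n n
        σ = Composition.inverse (Composition.inverse enumeration π) (Symmetry.inverse enumeration)

      ∑-single : ∀ f → (∀ {x y} → x ≈ y → f x M.≈ f y) → ∀ w →
                 (∀ x → ¬ x ≈ w → f x M.≈ M.ε) → ∑ f M.≈ f w
      ∑-single f f-cong w f≈ε = M.trans
        (sum-single (f ∘ to) (from w) λ j j≢w → f≈ε (to j) λ eq → j≢w (≡.sym (inverseʳ (sym eq))))
        (f-cong (strictlyInverseˡ w))

  module RingSummation {c ℓ′} (K : CommutativeRing c ℓ′) where
    private module K = CommutativeRing K
    open K using (_+_; _*_)
    open SemiringSum K.semiring
      using (∑-comm; *-distribˡ-sum; *-distribʳ-sum)
    open Summation K.+-commutativeMonoid public renaming (∑-∙ to ∑-+)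

    opaque
      unfolding ∑

      *-∑ : ∀ k f → k * ∑ f K.≈ ∑ (λ x → k * f x)
      *-∑ k f = *-distribˡ-sum k (f ∘ to)

      ∑-* : ∀ k f → ∑ f * k K.≈ ∑ (λ x → f x * k)
      ∑-* k f = *-distribʳ-sum k (f ∘ to)

      ∑-swap : (f : Carrier → Carrier → K.Carrier) →
               ∑ (λ x → ∑ (λ y → f x y)) K.≈ ∑ (λ y → ∑ (λ x → f x y))
      ∑-swap f = ∑-comm {n} {n} (λ i j → f (to i) (to j))

    -- The difference of `f` and `g` is supported at `w`. This is how an identity valid only away
    -- from `ε` is summed over the whole group: the exceptional values are carried along as
    -- correction terms.
    ∑-agree : ∀ f g → (∀ {x y} → x ≈ y → f x K.≈ f y) → (∀ {x y} → x ≈ y → g x K.≈ g y) →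
              ∀ w → (∀ x → ¬ x ≈ w → f x K.≈ g x) → ∑ f + g w K.≈ ∑ g + f w
    ∑-agree f g f-cong g-cong w f≈g = begin
      ∑ f + g w                              ≈⟨ K.+-congʳ (∑-cong λ x → cancel (f x) (g x)) ⟩
      ∑ (λ x → (f x K.- g x) + g x) + g w    ≈⟨ K.+-congʳ (∑-+ (λ x → f x K.- g x) g) ⟩
      ∑ (λ x → f x K.- g x) + ∑ g + g w
        ≈⟨ K.+-congʳ (K.+-congʳ (∑-single _ (λ eq → K.+-cong (f-cong eq) (K.-‿cong (g-cong eq))) w
             λ x x≉w → K.trans (K.+-congʳ (f≈g x x≉w)) (K.-‿inverseʳ (g x)))) ⟩
      (f w K.- g w) + ∑ g + g w              ≈⟨ K.+-congʳ (K.+-comm _ _) ⟩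
      ∑ g + (f w K.- g w) + g w              ≈⟨ K.+-assoc _ _ _ ⟩
      ∑ g + (f w K.- g w + g w)              ≈⟨ K.+-congˡ (cancel (f w) (g w)) ⟨
      ∑ g + f w                              ∎
      where
      open SetoidReasoning K.setoid
      cancel : ∀ x y → x K.≈ (x K.- y) + y
      cancel x y = K.sym (K.trans (K.+-assoc x (K.- y) y)
        (K.trans (K.+-congˡ (K.-‿inverseˡ y)) (K.+-identityʳ x)))

-- Cancellation by units and in fields

module UnitProperties {r ℓ} (R : CommutativeRing r ℓ) where
  open CommutativeRing R
  open SemiringSolver commutativeSemiring using (solve; _:=_; _:*_)
  open SetoidReasoning setoid

  -- The inverse is passed explicitly, so that the lemma also serves in ℂ.
  unit-cancelˡ : ∀ {u u⁻¹ x y} → u * u⁻¹ ≈ 1# → u * x ≈ u * y → x ≈ y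
  unit-cancelˡ {u} {u⁻¹} {x} {y} inv eq = begin
    x                ≈⟨ lemma x ⟨
    u⁻¹ * (u * x)    ≈⟨ *-congˡ eq ⟩
    u⁻¹ * (u * y)    ≈⟨ lemma y ⟩
    y                ∎
    where
    lemma : ∀ z → u⁻¹ * (u * z) ≈ z
    lemma z = trans (sym (*-assoc u⁻¹ u z))
      (trans (*-congʳ (trans (*-comm u⁻¹ u) inv)) (*-identityˡ z))

  -- Turns the definition of the bicharacter as a quotient into the product law `a-∙`.
  polarization : ∀ {x x⁻¹ y y⁻¹} z → x * x⁻¹ ≈ 1# → y * y⁻¹ ≈ 1# →
                 z ≈ x * y * (z * (x⁻¹ * y⁻¹))
  polarization {x} {x⁻¹} {y} {y⁻¹} z xx⁻¹≈1 yy⁻¹≈1 = sym (begin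
    x * y * (z * (x⁻¹ * y⁻¹))
      ≈⟨ solve 5 (λ x y z p q → x :* y :* (z :* (p :* q)) := z :* (x :* p :* (y :* q)))
           refl x y z x⁻¹ y⁻¹ ⟩
    z * (x * x⁻¹ * (y * y⁻¹))    ≈⟨ *-congˡ (*-cong xx⁻¹≈1 yy⁻¹≈1) ⟩
    z * (1# * 1#)                ≈⟨ trans (*-congˡ (*-identityˡ 1#)) (*-identityʳ z) ⟩
    z                            ∎)

module FieldProperties {c ℓ} (K : CommutativeRing c ℓ)
  (inverse : ∀ x → ¬ CommutativeRing._≈_ K x (CommutativeRing.0# K) →
    ∃[ y ] CommutativeRing._≈_ K (CommutativeRing._*_ K x y) (CommutativeRing.1# K)) where
  open CommutativeRing K
  open SemiringSolver commutativeSemiring using (solve; _:=_; _:+_)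
  open SetoidReasoning setoid

  open UnitProperties K public

  *-cancelˡ : ∀ {x y z} → x ≉ 0# → x * y ≈ x * z → y ≈ z
  *-cancelˡ x≉0 = unit-cancelˡ (proj₂ (inverse _ x≉0))

  x*y≈0⇒y≈0 : ∀ {x y} → x ≉ 0# → x * y ≈ 0# → y ≈ 0#
  x*y≈0⇒y≈0 x≉0 eq = *-cancelˡ x≉0 (trans eq (sym (zeroʳ _)))

  +-cancelʳ : ∀ z {x y} → x + z ≈ y + z → x ≈ y
  +-cancelʳ z = RingProperties.+-cancelʳ ring z _ _

  -- Subtraction of two equations, phrased with sums only. It is meant for two instances of
  -- `relation`, which differ only in the terms containing `f (β ⁻¹)`.
  exchange : ∀ {p q r x x′ y y′} → p + x + q ≈ r + x′ → p + y + q ≈ r + y′ → x + y′ ≈ y + x′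
  exchange {p} {q} {r} {x} {x′} {y} {y′} eq eq′ = +-cancelʳ (p + q + r) (begin
    x + y′ + (p + q + r)
      ≈⟨ solve 5 (λ x y′ p q r → x :+ y′ :+ (p :+ q :+ r) := (p :+ x :+ q) :+ (r :+ y′)) refl x y′ p q r ⟩
    (p + x + q) + (r + y′)
      ≈⟨ +-cong eq (sym eq′) ⟩
    (r + x′) + (p + y + q)
      ≈⟨ solve 5 (λ y x′ p q r → (r :+ x′) :+ (p :+ y :+ q) := y :+ x′ :+ (p :+ q :+ r)) refl y x′ p q r ⟩
    y + x′ + (p + q + r) ∎)

  -- The hypothesis amounts to (u - v)(x - y) = 0.
  crossed : ∀ {u v x y} → u ≉ v → u * x + v * y ≈ u * y + v * x → x ≈ y
  crossed {u} {v} {x} {y} u≉v eq = *-cancelˡ u-v≉0 (+-cancelʳ (v * x + v * y) (begin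
    (u - v) * x + (v * x + v * y)    ≈⟨ regroup x y ⟩
    u * x + v * y                    ≈⟨ eq ⟩
    u * y + v * x                    ≈⟨ regroup y x ⟨
    (u - v) * y + (v * y + v * x)    ≈⟨ +-congˡ (+-comm _ _) ⟩
    (u - v) * y + (v * x + v * y)    ∎))
    where
    u-v≉0 : u - v ≉ 0#
    u-v≉0 = u≉v ∘ RingProperties.x∙y⁻¹≈ε⇒x≈y ring u v

    regroup : ∀ x y → (u - v) * x + (v * x + v * y) ≈ u * x + v * y
    regroup x y = trans (sym (+-assoc _ _ _)) (+-congʳ (trans (sym (distribʳ x (u - v) v))
      (*-congʳ (trans (+-assoc u (- v) v) (trans (+-congˡ (-‿inverseˡ v)) (+-identityʳ u))))))

  *-≉0 : ∀ {x y} → x ≉ 0# → y ≉ 0# → x * y ≉ 0#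
  *-≉0 x≉0 y≉0 eq = y≉0 (x*y≈0⇒y≈0 x≉0 eq)

-- Identities and reindexings in an abelian group

module GroupIdentities {g ℓ} (G : AbelianGroup g ℓ) where
  open AbelianGroup G
  open AbelianGroupProperties G
  open SetoidReasoning setoid

  x-[x-y]≈y : ∀ x y → x - (x - y) ≈ y
  x-[x-y]≈y x y = begin
    x ∙ (x - y) ⁻¹  ≈⟨ ∙-congˡ (⁻¹-anti-homo‿- x y) ⟩
    x ∙ (y - x)     ≈⟨ comm _ _ ⟩
    (y - x) ∙ x       ≈⟨ //-rightDividesˡ x y ⟩
    y               ∎

  x⁻¹∙[x∙y]≈y : ∀ x y → x ⁻¹ ∙ (x ∙ y) ≈ y
  x⁻¹∙[x∙y]≈y x y = \\-leftDividesʳ x y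

  x∙y-x≈y : ∀ x y → x ∙ (y - x) ≈ y
  x∙y-x≈y x y = trans (comm _ _) (//-rightDividesˡ x y)

  reflected : ∀ {y t t′} z → y ∙ t ≈ t′ ⁻¹ → (y - z) ∙ t ≈ (z ∙ t′) ⁻¹
  reflected {y} {t} {t′} z eq = begin
    y ∙ z ⁻¹ ∙ t      ≈⟨ ∙-congʳ (comm _ _) ⟩
    z ⁻¹ ∙ y ∙ t      ≈⟨ assoc _ _ _ ⟩
    z ⁻¹ ∙ (y ∙ t)    ≈⟨ ∙-congˡ eq ⟩
    z ⁻¹ ∙ t′ ⁻¹      ≈⟨ ⁻¹-∙-comm z t′ ⟩
    (z ∙ t′) ⁻¹       ∎

  [x∙z]-[y∙z]≈x-y : ∀ x y z → (x ∙ z) - (y ∙ z) ≈ x - y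
  [x∙z]-[y∙z]≈x-y x y z = begin
    x ∙ z ∙ (y ∙ z) ⁻¹        ≈⟨ ∙-congˡ (⁻¹-anti-homo-∙ y z) ⟩
    x ∙ z ∙ (z ⁻¹ ∙ y ⁻¹)     ≈⟨ assoc _ _ _ ⟨
    x ∙ z ∙ z ⁻¹ ∙ y ⁻¹       ≈⟨ ∙-congʳ (//-rightDividesʳ z x) ⟩
    x - y                     ∎

  negation : Inverse setoid setoid
  negation = record
    { to = _⁻¹ ; from = _⁻¹ ; to-cong = ⁻¹-cong ; from-cong = ⁻¹-cong
    ; inverse = (λ eq → trans (⁻¹-cong eq) (⁻¹-involutive _))
              , (λ eq → trans (⁻¹-cong eq) (⁻¹-involutive _))
    }

  translation reflection : Carrier → Inverse setoid setoid
  translation w = record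
    { to = _∙ w ; from = _- w ; to-cong = ∙-congʳ ; from-cong = ∙-congʳ
    ; inverse = (λ eq → trans (∙-congʳ eq) (//-rightDividesˡ w _))
              , (λ eq → trans (∙-congʳ eq) (//-rightDividesʳ w _))
    }
  reflection w = record
    { to = λ x → w - x ; from = λ x → w - x ; to-cong = w-cong ; from-cong = w-cong
    ; inverse = (λ eq → trans (w-cong eq) (x-[x-y]≈y w _))
              , (λ eq → trans (w-cong eq) (x-[x-y]≈y w _))
    }
    where
    w-cong : ∀ {x y} → x ≈ y → w - x ≈ w - y
    w-cong eq = ∙-congˡ (⁻¹-cong eq)

-- Quadratic forms and quantum dilogarithms over a field

record QuadraticForm {r ℓ g ℓg} (R : CommutativeRing r ℓ) (G : AbelianGroup g ℓg)
                     : Set (r ⊔ ℓ ⊔ g ⊔ ℓg) where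
  private module R = CommutativeRing R
  open R using (_≈_; _*_; 1#)
  open AbelianGroup G using (_∙_; _⁻¹) renaming (Carrier to A; _≈_ to _≈ᴳ_)
  field
    a a⁻¹     : A → R.Carrier
    b         : A → A → R.Carrier
    a-inverse : ∀ x → a x * a⁻¹ x ≈ 1#
    a-cong    : ∀ {x y} → x ≈ᴳ y → a x ≈ a y
    a-even    : ∀ x → a x ≈ a (x ⁻¹)
    a-∙       : ∀ x y → a (x ∙ y) ≈ a x * a y * b x y
    b-homoˡ   : ∀ x y z → b (x ∙ y) z ≈ b x z * b y z
    b-homoʳ   : ∀ x y z → b x (y ∙ z) ≈ b x y * b x z

module QuadraticFormProperties {r ℓ g ℓg} {R : CommutativeRing r ℓ} {G : AbelianGroup g ℓg}
                               (form : QuadraticForm R G) where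
  open CommutativeRing R hiding (zero; _-_)
  open QuadraticForm form
  private module G = AbelianGroup G
  open G using (_∙_; ε; _⁻¹; _-_) renaming (Carrier to A; _≈_ to _≈ᴳ_)
  open SemiringSolver commutativeSemiring using (solve; _:=_; _:*_)
  open RawMonoidDefinitions G.rawMonoid using () renaming (_×_ to _·_)
  open Exponentiation commutativeSemiring using (_^_; ^-congˡ; ^-homo-*; ^-distrib-*)
  open UnitProperties R
  open SetoidReasoning setoid

  a*a-inverse : ∀ x y → a x * a y * (a⁻¹ x * a⁻¹ y) ≈ 1#
  a*a-inverse x y = begin
    a x * a y * (a⁻¹ x * a⁻¹ y)
      ≈⟨ solve 4 (λ p q r t → p :* q :* (r :* t) := p :* r :* (q :* t)) refl _ _ _ _ ⟩
    a x * a⁻¹ x * (a y * a⁻¹ y)    ≈⟨ *-cong (a-inverse x) (a-inverse y) ⟩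
    1# * 1#                        ≈⟨ *-identityˡ 1# ⟩
    1#                             ∎

  b-inverse : ∀ x y → b x y * (a x * a y * a⁻¹ (x ∙ y)) ≈ 1#
  b-inverse x y = begin
    b x y * (a x * a y * a⁻¹ (x ∙ y))    ≈⟨ *-assoc _ _ _ ⟨
    b x y * (a x * a y) * a⁻¹ (x ∙ y)    ≈⟨ *-congʳ (trans (*-comm _ _) (sym (a-∙ x y))) ⟩
    a (x ∙ y) * a⁻¹ (x ∙ y)              ≈⟨ a-inverse (x ∙ y) ⟩
    1#                                   ∎

  -- By `a-∙` the form `a` determines `b`, so congruence and symmetry of `b` are inherited from
  -- `a (x ∙ y)`.
  b-cong : ∀ {x x′ y y′} → x ≈ᴳ x′ → y ≈ᴳ y′ → b x y ≈ b x′ y′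
  b-cong {x} {x′} {y} {y′} x≈ y≈ = unit-cancelˡ (a*a-inverse x y) (begin
    a x * a y * b x y        ≈⟨ a-∙ x y ⟨
    a (x ∙ y)                ≈⟨ a-cong (G.∙-cong x≈ y≈) ⟩
    a (x′ ∙ y′)              ≈⟨ a-∙ x′ y′ ⟩
    a x′ * a y′ * b x′ y′    ≈⟨ *-congʳ (*-cong (a-cong x≈) (a-cong y≈)) ⟨
    a x * a y * b x′ y′      ∎)

  b-comm : ∀ x y → b x y ≈ b y x
  b-comm x y = unit-cancelˡ (a*a-inverse x y) (begin
    a x * a y * b x y    ≈⟨ a-∙ x y ⟨
    a (x ∙ y)            ≈⟨ a-cong (G.comm x y) ⟩
    a (y ∙ x)            ≈⟨ a-∙ y x ⟩
    a y * a x * b y x    ≈⟨ *-congʳ (*-comm _ _) ⟩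
    a x * a y * b y x    ∎)

  b-εˡ : ∀ y → b ε y ≈ 1#
  b-εˡ y = unit-cancelˡ (b-inverse ε y) (begin
    b ε y * b ε y    ≈⟨ b-homoˡ ε ε y ⟨
    b (ε ∙ ε) y      ≈⟨ b-cong (G.identityˡ ε) G.refl ⟩
    b ε y            ≈⟨ *-identityʳ _ ⟨
    b ε y * 1#       ∎)

  b-εʳ : ∀ x → b x ε ≈ 1#
  b-εʳ x = trans (b-comm x ε) (b-εˡ x)

  b-⁻¹ʳ : ∀ x y → b x y * b x (y ⁻¹) ≈ 1#
  b-⁻¹ʳ x y = begin
    b x y * b x (y ⁻¹)    ≈⟨ b-homoʳ x y (y ⁻¹) ⟨
    b x (y ∙ y ⁻¹)        ≈⟨ b-cong G.refl (G.inverseʳ y) ⟩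
    b x ε                 ≈⟨ b-εʳ x ⟩
    1#                    ∎

  a-ε : a ε ≈ 1#
  a-ε = unit-cancelˡ (a-inverse ε) (begin
    a ε * a ε          ≈⟨ *-identityʳ _ ⟨
    a ε * a ε * 1#     ≈⟨ *-congˡ (b-εˡ ε) ⟨
    a ε * a ε * b ε ε  ≈⟨ a-∙ ε ε ⟨
    a (ε ∙ ε)          ≈⟨ a-cong (G.identityˡ ε) ⟩
    a ε                ≈⟨ *-identityʳ _ ⟨
    a ε * 1#           ∎)

  -- The parallelogram law in multiplicative notation: `a` is even, and the factors `b x y` and
  -- `b x (y ⁻¹)` cancel.
  a-parallelogram : ∀ x y → a (x ∙ y) * a (x - y) ≈ (a x * a x) * (a y * a y)
  a-parallelogram x y = begin
    a (x ∙ y) * a (x - y)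
      ≈⟨ *-cong (a-∙ x y) (trans (a-∙ x (y ⁻¹)) (*-congʳ (*-congˡ (sym (a-even y))))) ⟩
    (a x * a y * b x y) * (a x * a y * b x (y ⁻¹))
      ≈⟨ solve 4 (λ p q r t → (p :* q :* r) :* (p :* q :* t) := (p :* p) :* (q :* q) :* (r :* t))
           refl _ _ _ _ ⟩
    (a x * a x) * (a y * a y) * (b x y * b x (y ⁻¹))
      ≈⟨ *-congˡ (b-⁻¹ʳ x y) ⟩
    (a x * a x) * (a y * a y) * 1#
      ≈⟨ *-identityʳ _ ⟩
    (a x * a x) * (a y * a y) ∎

  b-square : ∀ x → a x * a x ≈ b x x
  b-square x = unit-cancelˡ (a*a-inverse x x) (begin
    a x * a x * (a x * a x)      ≈⟨ a-parallelogram x x ⟨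
    a (x ∙ x) * a (x - x)        ≈⟨ *-congˡ (trans (a-cong (G.inverseʳ x)) a-ε) ⟩
    a (x ∙ x) * 1#               ≈⟨ *-identityʳ _ ⟩
    a (x ∙ x)                    ≈⟨ a-∙ x x ⟩
    a x * a x * b x x            ∎)

  b-^ : ∀ m x y → b x y ^ m ≈ b (m · x) y
  b-^ ℕ.zero    x y = sym (b-εˡ y)
  b-^ (ℕ.suc m) x y = trans (*-congˡ (b-^ m x y)) (sym (b-homoˡ x (m · x) y))

  -- The square of `a x` is `b x x`, whose m-th power is `b (m · x) x`. Over ℂ this makes the values
  -- of the form algebraic, over ℚ̄ it makes them integral.
  a-root-of-unity : ∀ m {x} → m · x ≈ᴳ ε → a x ^ (m ℕ.+ m) ≈ 1#
  a-root-of-unity m {x} mx≈ε = begin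
    a x ^ (m ℕ.+ m)      ≈⟨ ^-homo-* (a x) m m ⟩
    a x ^ m * a x ^ m    ≈⟨ ^-distrib-* (a x) (a x) m ⟨
    (a x * a x) ^ m      ≈⟨ ^-congˡ m (b-square x) ⟩
    b x x ^ m            ≈⟨ b-^ m x x ⟩
    b (m · x) x          ≈⟨ b-cong mx≈ε G.refl ⟩
    b ε x                ≈⟨ b-εˡ x ⟩
    1#                   ∎

-- The defining equation is multiplied by s = √N, so that c is √N C.
record FieldDilogarithm {k ℓ g ℓg} (K : CommutativeRing k ℓ) (G : AbelianGroup g ℓg) (n : ℕ)
                        : Set (k ⊔ ℓ ⊔ g ⊔ ℓg) where
  private module K = CommutativeRing K
  open K using (_≈_; _≉_; _+_; _*_; 0#; 1#)
  open AbelianGroup G using (_∙_; ε; _⁻¹; _-_) renaming (Carrier to A; _≈_ to _≈ᴳ_)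
  open RawMonoidDefinitions K.+-rawMonoid using () renaming (_×_ to _·_)
  field
    ≈0?         : ∀ x → Dec (x ≈ 0#)
    1≉0         : 1# ≉ 0#
    inverse     : ∀ x → x ≉ 0# → ∃[ y ] x * y ≈ 1#
    enumeration : Inverse (≡.setoid (Fin n)) (AbelianGroup.setoid G)
    odd         : ∀ x → x ∙ x ≈ᴳ ε → x ≈ᴳ ε

  open FiniteSetoid enumeration public using (_≟_; avoid)
  open FiniteSetoid.RingSummation enumeration K public

  field
    form        : QuadraticForm K G

  open QuadraticForm form public

  field
    nondegenerate : ∀ x → (∀ y → b x y ≈ 1#) → x ≈ᴳ ε

    s c     : K.Carrier
    s≉0     : s ≉ 0#
    s²≈n    : s * s ≈ n · 1#
    c≉0     : c ≉ 0#

    E       : A → K.Carrier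
    E-cong  : ∀ {x y} → x ≈ᴳ y → E x ≈ E y
    dilogarithm : ∀ x y → s * (b x y * E x * E y) ≈
      c + ∑ (λ z → E (y - z) * E z * a z * E (x - z))
    small-order : n ℕ.≤ 4 → E ε * E ε ≈ s * E ε + 1#

-- Relations between E and its Fourier transform

module FieldDilogarithmProperties {k ℓ g ℓg} {K : CommutativeRing k ℓ} {G : AbelianGroup g ℓg} {n : ℕ}
                                  (𝓔 : FieldDilogarithm K G n) where
  private module K = CommutativeRing K
  open K hiding (Carrier; zero; _-_)
  open FieldDilogarithm 𝓔
  open FieldProperties K inverse
  private module G = AbelianGroup G
  open G using (_∙_; ε; _⁻¹; _-_) renaming (Carrier to A; _≈_ to _≈ᴳ_; _≉_ to _≉ᴳ_)
  open AbelianGroupProperties G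
    using (inverseʳ-unique; //-cong₂; //-rightDividesʳ; ⁻¹-involutive; ε⁻¹≈ε;
           ⁻¹-anti-homo‿-; x∙y⁻¹≈ε⇒x≈y; ⁻¹-injective)
  open SemiringSolver commutativeSemiring using (solve; _:=_; _:+_; _:*_)
  open SetoidReasoning setoid

  open GroupIdentities G
  open QuadraticFormProperties form

  unit≉0 : ∀ {u u⁻¹} → u * u⁻¹ ≈ 1# → u ≉ 0#
  unit≉0 inv u≈0 = 1≉0 (trans (sym inv) (trans (*-congʳ u≈0) (zeroˡ _)))

  a≉0 : ∀ x → a x ≉ 0#
  a≉0 x = unit≉0 (a-inverse x)

  b≉0 : ∀ x y → b x y ≉ 0#
  b≉0 x y = unit≉0 (b-inverse x y)

  D : A → K.Carrier
  D α = ∑ λ x → b x α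

  D-ε : D ε ≈ s * s
  D-ε = trans (∑-cong b-εʳ) (trans (∑-const 1#) (sym s²≈n))

  -- Orthogonality of characters: translating the summation variable by `y` multiplies `D α` by
  -- `b α y`, so a non-zero `D α` would make `b α` trivial, against non-degeneracy.
  D-≉ε : ∀ {α} → α ≉ᴳ ε → D α ≈ 0#
  D-≉ε {α} α≉ε with ≈0? (D α)
  ... | yes D≈0 = D≈0
  ... | no D≉0 = contradiction (nondegenerate α λ y → *-cancelˡ D≉0 (begin
    D α * b α y                 ≈⟨ *-congˡ (b-comm α y) ⟩
    D α * b y α                 ≈⟨ ∑-* _ _ ⟩
    ∑ (λ x → b x α * b y α)     ≈⟨ ∑-cong (λ x → b-homoˡ x y α) ⟨
    ∑ (λ x → b (x ∙ y) α)       ≈⟨ ∑-permute _ (λ eq → b-cong eq G.refl) (translation y) ⟨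
    D α                         ≈⟨ *-identityʳ _ ⟨
    D α * 1#                    ∎)) α≉ε

  F : A → K.Carrier
  F α = ∑ λ x → b x α * E x

  H : A → A → K.Carrier
  H y t = ∑ λ z → E (y - z) * E z * a (z ∙ t)

  F-cong : ∀ {x y} → x ≈ᴳ y → F x ≈ F y
  F-cong eq = ∑-cong λ z → *-congʳ (b-cong G.refl eq)

  F-shift : ∀ α z → ∑ (λ x → b x α * E (x - z)) ≈ b z α * F α
  F-shift α z = begin
    ∑ (λ x → b x α * E (x - z))
      ≈⟨ ∑-permute _ (λ eq → *-cong (b-cong eq G.refl) (E-cong (//-cong₂ eq G.refl))) (translation z) ⟩
    ∑ (λ x → b (x ∙ z) α * E (x ∙ z - z))
      ≈⟨ ∑-cong (λ x → trans (*-cong (trans (b-homoˡ x z α) (*-comm _ _)) (E-cong (//-rightDividesʳ z x)))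
                             (*-assoc _ _ _)) ⟩
    ∑ (λ x → b z α * (b x α * E x))
      ≈⟨ *-∑ _ _ ⟨
    b z α * F α ∎

  -- The substitution z ↦ y - z swaps the two factors `E` and turns the argument z + t of `a` into
  -- -(z + t′), which evenness of `a` absorbs.
  H-symmetric : ∀ {y t t′} → y ∙ t ≈ᴳ t′ ⁻¹ → H y t ≈ H y t′
  H-symmetric {y} {t} {t′} eq = begin
    H y t
      ≈⟨ ∑-permute _ (λ p → *-cong (*-cong (E-cong (//-cong₂ G.refl p)) (E-cong p)) (a-cong (G.∙-congʳ p)))
           (reflection y) ⟩
    ∑ (λ z → E (y - (y - z)) * E (y - z) * a ((y - z) ∙ t))
      ≈⟨ ∑-cong (λ z → *-cong (trans (*-congʳ (E-cong (x-[x-y]≈y y z))) (*-comm _ _))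
                              (trans (a-cong (reflected z eq)) (sym (a-even _)))) ⟩
    H y t′ ∎

  -- Multiply the defining equation by `a α * b x α` and sum over x. On the right, the sum over x
  -- for fixed z is a shifted transform, contributing `b z α * F α`; the factor `a α` then completes
  -- `a z * b z α` to `a (z ∙ α)`.
  fourier : ∀ α y → s * a α * E y * F (α ∙ y) ≈ a α * (c * D α) + F α * H y α
  fourier α y = begin
    s * a α * E y * F (α ∙ y)
      ≈⟨ *-∑ _ _ ⟩
    ∑ (λ x → s * a α * E y * (b x (α ∙ y) * E x))
      ≈⟨ ∑-cong (λ x → trans (*-congˡ (*-congʳ (b-homoʳ x α y)))
           (solve 6 (λ s a e p q x → s :* a :* e :* (p :* q :* x) := a :* p :* (s :* (q :* x :* e)))
              refl s (a α) (E y) (b x α) (b x y) (E x))) ⟩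
    ∑ (λ x → a α * b x α * (s * (b x y * E x * E y)))
      ≈⟨ ∑-cong (λ x → trans (*-congˡ (dilogarithm x y)) (trans (distribˡ _ _ _)
           (+-cong (solve 3 (λ p q r → p :* q :* r := p :* r :* q) refl _ _ _) (*-∑ _ _)))) ⟩
    ∑ (λ x → a α * c * b x α + ∑ (λ z → a α * b x α * term x z))
      ≈⟨ ∑-+ _ _ ⟩
    ∑ (λ x → a α * c * b x α) + ∑ (λ x → ∑ (λ z → a α * b x α * term x z))
      ≈⟨ +-cong (trans (sym (*-∑ _ _)) (*-assoc _ _ _))
                (trans (∑-swap _) (trans (∑-cong inner) (sym (*-∑ _ _)))) ⟩
    a α * (c * D α) + F α * H y α ∎
    where
    term : A → A → K.Carrier
    term x z = E (y - z) * E z * a z * E (x - z)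

    inner : ∀ z → ∑ (λ x → a α * b x α * term x z) ≈ F α * (E (y - z) * E z * a (z ∙ α))
    inner z = begin
      ∑ (λ x → a α * b x α * term x z)
        ≈⟨ ∑-cong (λ x → solve 6 (λ p q e f r h → p :* q :* (e :* f :* r :* h) := p :* e :* f :* r :* (q :* h))
             refl (a α) (b x α) (E (y - z)) (E z) (a z) (E (x - z))) ⟩
      ∑ (λ x → a α * E (y - z) * E z * a z * (b x α * E (x - z)))
        ≈⟨ trans (sym (*-∑ _ _)) (*-congˡ (F-shift α z)) ⟩
      a α * E (y - z) * E z * a z * (b z α * F α)
        ≈⟨ solve 6 (λ p e f r q h → p :* e :* f :* r :* (q :* h) := h :* (e :* f :* (r :* p :* q)))
             refl (a α) (E (y - z)) (E z) (a z) (b z α) (F α) ⟩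
      F α * (E (y - z) * E z * (a z * a α * b z α))
        ≈⟨ *-congˡ (*-congˡ (a-∙ z α)) ⟨
      F α * (E (y - z) * E z * a (z ∙ α)) ∎

  fourier-ε : ∀ y → s * E y * F y ≈ c * (s * s) + F ε * H y ε
  fourier-ε y = begin
    s * E y * F y
      ≈⟨ *-cong (*-congʳ (trans (*-congˡ a-ε) (*-identityʳ s))) (F-cong (G.identityˡ y)) ⟨
    s * a ε * E y * F (ε ∙ y)            ≈⟨ fourier ε y ⟩
    a ε * (c * D ε) + F ε * H y ε        ≈⟨ +-congʳ (trans (*-congʳ a-ε) (trans (*-identityˡ _) (*-congˡ D-ε))) ⟩
    c * (s * s) + F ε * H y ε            ∎

  fourier-≉ε : ∀ {α} → α ≉ᴳ ε → ∀ y → s * a α * E y * F (α ∙ y) ≈ F α * H y α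
  fourier-≉ε {α} α≉ε y = begin
    s * a α * E y * F (α ∙ y)            ≈⟨ fourier α y ⟩
    a α * (c * D α) + F α * H y α        ≈⟨ +-congʳ (*-congˡ (*-congˡ (D-≉ε α≉ε))) ⟩
    a α * (c * 0#) + F α * H y α         ≈⟨ +-congʳ (trans (*-congˡ (zeroʳ c)) (zeroʳ _)) ⟩
    0# + F α * H y α                     ≈⟨ +-identityˡ _ ⟩
    F α * H y α                          ∎

  cs²≉0 : c * (s * s) ≉ 0#
  cs²≉0 = *-≉0 c≉0 (*-≉0 s≉0 s≉0)

  -- In `fourier-ε` at `ε` every term except the non-zero constant contains `F ε`.
  F-ε≉0 : F ε ≉ 0#
  F-ε≉0 F≈0 = cs²≉0 (begin
    c * (s * s)                  ≈⟨ +-identityʳ _ ⟨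
    c * (s * s) + 0#             ≈⟨ +-congˡ (trans (*-congʳ F≈0) (zeroˡ _)) ⟨
    c * (s * s) + F ε * H ε ε    ≈⟨ fourier-ε ε ⟨
    s * E ε * F ε                ≈⟨ *-congˡ F≈0 ⟩
    s * E ε * 0#                 ≈⟨ zeroʳ _ ⟩
    0#                           ∎)

  ⁻¹-≉ε : ∀ {x} → x ≉ᴳ ε → x ⁻¹ ≉ᴳ ε
  ⁻¹-≉ε x≉ε eq = x≉ε (⁻¹-injective (G.trans eq (G.sym ε⁻¹≈ε)))

  -- Eliminates H y ε from fourier-ε and the case α = −y of fourier-≉ε.
  F-reflection : ∀ {y} → y ≉ᴳ ε →
    s * (E y * F y * F (y ⁻¹)) ≈ c * (s * s) * F (y ⁻¹) + F ε * (s * a y * E y * F ε)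
  F-reflection {y} y≉ε = begin
    s * (E y * F y * F (y ⁻¹))
      ≈⟨ solve 4 (λ s e f g → s :* (e :* f :* g) := s :* e :* f :* g) refl _ _ _ _ ⟩
    s * E y * F y * F (y ⁻¹)
      ≈⟨ *-congʳ (fourier-ε y) ⟩
    (c * (s * s) + F ε * H y ε) * F (y ⁻¹)
      ≈⟨ solve 4 (λ p q r t → (p :+ q :* r) :* t := p :* t :+ q :* (t :* r)) refl _ _ _ _ ⟩
    c * (s * s) * F (y ⁻¹) + F ε * (F (y ⁻¹) * H y ε)
      ≈⟨ +-congˡ (*-congˡ (begin
        F (y ⁻¹) * H y ε                         ≈⟨ *-congˡ (H-symmetric
                                                      (G.trans (G.inverseʳ y) (G.sym ε⁻¹≈ε))) ⟨
        F (y ⁻¹) * H y (y ⁻¹)                    ≈⟨ fourier-≉ε (⁻¹-≉ε y≉ε) y ⟨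
        s * a (y ⁻¹) * E y * F (y ⁻¹ ∙ y)        ≈⟨ *-cong (*-congʳ (*-congˡ (sym (a-even y))))
                                                           (F-cong (G.inverseˡ y)) ⟩
        s * a y * E y * F ε                      ∎)) ⟩
    c * (s * s) * F (y ⁻¹) + F ε * (s * a y * E y * F ε) ∎

  -- In `F-reflection` the factor `E y` is missing from one term only, a non-zero multiple of
  -- `F (y ⁻¹)`. The converse below is the same with the roles exchanged: `F (y ⁻¹)` is missing only
  -- from a non-zero multiple of `E y`.
  E≈0⇒F≈0 : ∀ {y} → y ≉ᴳ ε → E y ≈ 0# → F (y ⁻¹) ≈ 0#
  E≈0⇒F≈0 {y} y≉ε E≈0 = x*y≈0⇒y≈0 cs²≉0 (begin
    c * (s * s) * F (y ⁻¹)
      ≈⟨ +-identityʳ _ ⟨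
    c * (s * s) * F (y ⁻¹) + 0#
      ≈⟨ +-congˡ (trans (*-congˡ (trans (*-congʳ (trans (*-congˡ E≈0) (zeroʳ _))) (zeroˡ _))) (zeroʳ _)) ⟨
    c * (s * s) * F (y ⁻¹) + F ε * (s * a y * E y * F ε)
      ≈⟨ F-reflection y≉ε ⟨
    s * (E y * F y * F (y ⁻¹))
      ≈⟨ *-congˡ (trans (*-congʳ (trans (*-congʳ E≈0) (zeroˡ _))) (zeroˡ _)) ⟩
    s * 0#
      ≈⟨ zeroʳ s ⟩
    0# ∎)

  F≈0⇒E≈0 : ∀ {y} → y ≉ᴳ ε → F (y ⁻¹) ≈ 0# → E y ≈ 0#
  F≈0⇒E≈0 {y} y≉ε F≈0 = x*y≈0⇒y≈0 (*-≉0 F-ε≉0 (*-≉0 (*-≉0 s≉0 (a≉0 y)) F-ε≉0)) (begin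
    F ε * (s * a y * F ε) * E y
      ≈⟨ solve 4 (λ f s a e → f :* (s :* a :* f) :* e := f :* (s :* a :* e :* f)) refl _ _ _ _ ⟩
    F ε * (s * a y * E y * F ε)
      ≈⟨ +-identityˡ _ ⟨
    0# + F ε * (s * a y * E y * F ε)
      ≈⟨ +-congʳ (trans (*-congˡ F≈0) (zeroʳ _)) ⟨
    c * (s * s) * F (y ⁻¹) + F ε * (s * a y * E y * F ε)
      ≈⟨ F-reflection y≉ε ⟨
    s * (E y * F y * F (y ⁻¹))
      ≈⟨ *-congˡ (trans (*-congˡ F≈0) (zeroʳ _)) ⟩
    s * 0#
      ≈⟨ zeroʳ s ⟩
    0# ∎)

  -- A zero of E at y ≠ 0 kills every term of the sum in the defining equation.
  E≉0 : ∀ {y} → y ≉ᴳ ε → E y ≉ 0#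
  E≉0 {y} y≉ε E≈0 = c≉0 (begin
    c                                                         ≈⟨ +-identityʳ c ⟨
    c + 0#                                                    ≈⟨ +-congˡ (trans (∑-cong (λ z → trans
      (solve 4 (λ p q r t → p :* q :* r :* t := p :* r :* (q :* t)) refl _ _ _ _)
      (trans (*-congˡ (vanish z)) (zeroʳ _)))) ∑-zero) ⟨
    c + ∑ (λ z → E (ε - z) * E z * a z * E (y - z))           ≈⟨ dilogarithm y ε ⟨
    s * (b y ε * E y * E ε)
      ≈⟨ *-congˡ (trans (*-congʳ (trans (*-congˡ E≈0) (zeroʳ _))) (zeroˡ _)) ⟩
    s * 0#                                                    ≈⟨ zeroʳ s ⟩
    0#                                                        ∎)
    where
    ∑-zero : ∑ (λ _ → 0#) ≈ 0#
    ∑-zero = trans (∑-cong (λ _ → sym (zeroˡ 0#))) (trans (sym (*-∑ 0# (λ _ → 0#))) (zeroˡ _))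

    -- With `F (y ⁻¹)` zero, the right side of `fourier-≉ε` at α = -y vanishes for every `w`.
    EF≈0 : ∀ w → E w * F (y ⁻¹ ∙ w) ≈ 0#
    EF≈0 w = x*y≈0⇒y≈0 (*-≉0 s≉0 (a≉0 (y ⁻¹))) (begin
      s * a (y ⁻¹) * (E w * F (y ⁻¹ ∙ w))    ≈⟨ *-assoc _ _ _ ⟨
      s * a (y ⁻¹) * E w * F (y ⁻¹ ∙ w)      ≈⟨ fourier-≉ε (⁻¹-≉ε y≉ε) w ⟩
      F (y ⁻¹) * H w (y ⁻¹)                  ≈⟨ *-congʳ (E≈0⇒F≈0 y≉ε E≈0) ⟩
      0# * H w (y ⁻¹)                        ≈⟨ zeroˡ _ ⟩
      0#                                     ∎)

    -- If `E w` is non-zero, then F(w - y) = 0 and so E(y - w) = 0. That last implication requires w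
    -- ≠ y, but at w = y the factor `E w` is zero already.
    vanish : ∀ w → E w * E (y - w) ≈ 0#
    vanish w with ≈0? (E w) | w ≟ y
    ... | yes Ew≈0 | _       = trans (*-congʳ Ew≈0) (zeroˡ _)
    ... | no Ew≉0  | yes w≈y = contradiction (trans (E-cong w≈y) E≈0) Ew≉0
    ... | no Ew≉0  | no w≉y  = trans (*-congˡ (F≈0⇒E≈0
      (λ eq → w≉y (G.sym (x∙y⁻¹≈ε⇒x≈y y w eq)))
      (trans (F-cong (G.trans (⁻¹-anti-homo‿- y w) (G.comm _ _))) (x*y≈0⇒y≈0 Ew≉0 (EF≈0 w))))) (zeroʳ _)

  F≉0 : ∀ y → F y ≉ 0#
  F≉0 y F≈0 with y ≟ ε
  ... | yes y≈ε = F-ε≉0 (trans (F-cong (G.sym y≈ε)) F≈0)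
  ... | no y≉ε  = E≉0 (⁻¹-≉ε y≉ε) (F≈0⇒E≈0 (⁻¹-≉ε y≉ε) (trans (F-cong (⁻¹-involutive y)) F≈0))

  -- For w = y - x the values `H w (y ⁻¹)` and `H w x` agree, because w - y + x = 0. Evaluating both
  -- by `fourier-≉ε` removes H and shows that F(x) F(-x) / a(x) does not depend on x ≠ 0. The case x
  -- = y is separate because `E w` must be cancelled.
  F-norm : ∀ {x y} → x ≉ᴳ ε → y ≉ᴳ ε → F x * F (x ⁻¹) * a y ≈ F y * F (y ⁻¹) * a x
  F-norm {x} {y} x≉ε y≉ε with x ≟ y
  ... | yes x≈y = *-cong (*-cong (F-cong x≈y) (F-cong (G.⁻¹-cong x≈y))) (a-cong (G.sym x≈y))
  ... | no x≉y = *-cancelˡ (*-≉0 s≉0 (E≉0 w≉ε)) (begin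
    s * E w * (F x * F (x ⁻¹) * a y)
      ≈⟨ solve 5 (λ s e p q r → s :* e :* (p :* q :* r) := p :* (s :* r :* e :* q)) refl _ _ _ _ _ ⟩
    F x * (s * a y * E w * F (x ⁻¹))
      ≈⟨ *-congˡ (*-cong (*-congʳ (*-congˡ (a-even y))) (F-cong (G.sym (x⁻¹∙[x∙y]≈y y (x ⁻¹))))) ⟩
    F x * (s * a (y ⁻¹) * E w * F (y ⁻¹ ∙ w))
      ≈⟨ *-congˡ (fourier-≉ε (⁻¹-≉ε y≉ε) w) ⟩
    F x * (F (y ⁻¹) * H w (y ⁻¹))
      ≈⟨ *-congˡ (*-congˡ (H-symmetric eq)) ⟩
    F x * (F (y ⁻¹) * H w x)
      ≈⟨ solve 3 (λ p q r → p :* (q :* r) := q :* (p :* r)) refl _ _ _ ⟩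
    F (y ⁻¹) * (F x * H w x)
      ≈⟨ *-congˡ (fourier-≉ε x≉ε w) ⟨
    F (y ⁻¹) * (s * a x * E w * F (x ∙ w))
      ≈⟨ *-congˡ (*-congˡ (F-cong (x∙y-x≈y x y))) ⟩
    F (y ⁻¹) * (s * a x * E w * F y)
      ≈⟨ solve 5 (λ s e p q r → q :* (s :* r :* e :* p) := s :* e :* (p :* q :* r)) refl _ _ _ _ _ ⟩
    s * E w * (F y * F (y ⁻¹) * a x) ∎)
    where
    w = y - x
    w≉ε : w ≉ᴳ ε
    w≉ε eq = x≉y (G.sym (x∙y⁻¹≈ε⇒x≈y y x eq))
    eq : w ∙ y ⁻¹ ≈ᴳ x ⁻¹
    eq = G.trans (G.comm _ _) (x⁻¹∙[x∙y]≈y y (x ⁻¹))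

  f p : A → K.Carrier
  f x = a x * E x
  p x = E x * E (x ⁻¹) * a x

  f-cong : ∀ {x y} → x ≈ᴳ y → f x ≈ f y
  f-cong eq = *-cong (a-cong eq) (E-cong eq)

  p-cong : ∀ {x y} → x ≈ᴳ y → p x ≈ p y
  p-cong eq = *-cong (*-cong (E-cong eq) (E-cong (G.⁻¹-cong eq))) (a-cong eq)

  p≈f*E : ∀ x → p x ≈ f (x ⁻¹) * E x
  p≈f*E x = trans (solve 3 (λ p q r → p :* q :* r := r :* q :* p) refl _ _ _)
    (*-congʳ (*-congʳ (a-even x)))

  f≉0 : ∀ {x} → x ≉ᴳ ε → f x ≉ 0#
  f≉0 x≉ε = *-≉0 (a≉0 _) (E≉0 x≉ε)

  -- Multiply `F-reflection` at `y` by `f x` and at `x` by `f y`. The left sides agree by `F-norm`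
  -- and the terms with `F ε` squared are symmetric in x and y, so the remaining terms agree.
  F-proportional : ∀ {x y} → x ≉ᴳ ε → y ≉ᴳ ε → F (y ⁻¹) * f x ≈ F (x ⁻¹) * f y
  F-proportional {x} {y} x≉ε y≉ε = *-cancelˡ cs²≉0 (+-cancelʳ (F ε * F ε * s * (f x * f y)) (begin
    c * (s * s) * (F (y ⁻¹) * f x) + F ε * F ε * s * (f x * f y)
      ≈⟨ solve 8 (λ c g ax ex k s ay ey →
           c :* (g :* (ax :* ex)) :+ k :* k :* s :* (ax :* ex :* (ay :* ey)) :=
           (c :* g :+ k :* (s :* ay :* ey :* k)) :* (ax :* ex)) refl _ _ _ _ _ _ _ _ ⟩
    (c * (s * s) * F (y ⁻¹) + F ε * (s * a y * E y * F ε)) * (a x * E x)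
      ≈⟨ *-congʳ (F-reflection y≉ε) ⟨
    s * (E y * F y * F (y ⁻¹)) * (a x * E x)
      ≈⟨ solve 6 (λ s ey p q ax ex → s :* (ey :* p :* q) :* (ax :* ex) := s :* ey :* ex :* (p :* q :* ax))
           refl _ _ _ _ _ _ ⟩
    s * E y * E x * (F y * F (y ⁻¹) * a x)
      ≈⟨ *-congˡ (F-norm x≉ε y≉ε) ⟨
    s * E y * E x * (F x * F (x ⁻¹) * a y)
      ≈⟨ solve 6 (λ s ey ex p q ay → s :* ey :* ex :* (p :* q :* ay) := s :* (ex :* p :* q) :* (ay :* ey))
           refl _ _ _ _ _ _ ⟩
    s * (E x * F x * F (x ⁻¹)) * (a y * E y)
      ≈⟨ *-congʳ (F-reflection x≉ε) ⟩
    (c * (s * s) * F (x ⁻¹) + F ε * (s * a x * E x * F ε)) * (a y * E y)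
      ≈⟨ solve 8 (λ c g ax ex k s ay ey →
           (c :* g :+ k :* (s :* ax :* ex :* k)) :* (ay :* ey) :=
           c :* (g :* (ay :* ey)) :+ k :* k :* s :* (ax :* ex :* (ay :* ey))) refl _ _ _ _ _ _ _ _ ⟩
    c * (s * s) * (F (x ⁻¹) * f y) + F ε * F ε * s * (f x * f y) ∎))

  -- Let t be the constant value. The parallelogram law for γ and some β outside {0, γ, -γ} gives t²
  -- = t⁴, and for γ with itself gives t = t⁴, as 2γ ≠ 0 in odd order. Hence t = 1, so `a` and `b`
  -- are identically 1, against non-degeneracy.
  a-nonconstant : 3 ℕ.< n → ∀ {γ} → γ ≉ᴳ ε → ¬ (∀ {x y} → x ≉ᴳ ε → y ≉ᴳ ε → a x ≈ a y)
  a-nonconstant 3<n {γ} γ≉ε a-const = γ≉ε (nondegenerate γ λ y → *-cancelˡ (a≉0 (γ ∙ y)) (begin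
    a (γ ∙ y) * b γ y
      ≈⟨ *-congʳ (trans (a≈1 (γ ∙ y)) (sym (trans (*-cong (a≈1 γ) (a≈1 y)) (*-identityˡ 1#)))) ⟩
    a γ * a y * b γ y        ≈⟨ a-∙ γ y ⟨
    a (γ ∙ y)                ≈⟨ *-identityʳ _ ⟨
    a (γ ∙ y) * 1#           ∎))
    where
    t = a γ

    t²≈t⁴ : t * t ≈ (t * t) * (t * t)
    t²≈t⁴ with avoid 3<n ε γ (γ ⁻¹)
    ... | β , β≉ε , β≉γ , β≉γ⁻¹ = begin
      t * t                           ≈⟨ *-cong (a-const γ≉ε γβ≉ε) (a-const γ≉ε γ-β≉ε) ⟩
      a (γ ∙ β) * a (γ - β)           ≈⟨ a-parallelogram γ β ⟩
      (t * t) * (a β * a β)           ≈⟨ *-congˡ (*-cong (a-const β≉ε γ≉ε) (a-const β≉ε γ≉ε)) ⟩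
      (t * t) * (t * t)               ∎
      where
      γβ≉ε : γ ∙ β ≉ᴳ ε
      γβ≉ε eq = β≉γ⁻¹ (inverseʳ-unique γ β eq)
      γ-β≉ε : γ - β ≉ᴳ ε
      γ-β≉ε eq = β≉γ (G.sym (x∙y⁻¹≈ε⇒x≈y γ β eq))

    t≈t⁴ : t ≈ (t * t) * (t * t)
    t≈t⁴ = begin
      t                        ≈⟨ a-const γ≉ε (γ≉ε ∘ odd γ) ⟩
      a (γ ∙ γ)                ≈⟨ *-identityʳ _ ⟨
      a (γ ∙ γ) * 1#           ≈⟨ *-congˡ (trans (a-cong (G.inverseʳ γ)) a-ε) ⟨
      a (γ ∙ γ) * a (γ - γ)    ≈⟨ a-parallelogram γ γ ⟩
      (t * t) * (t * t)        ∎

    t≈1 : t ≈ 1#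
    t≈1 = *-cancelˡ (a≉0 γ) (trans t²≈t⁴ (trans (sym t≈t⁴) (sym (*-identityʳ t))))

    a≈1 : ∀ y → a y ≈ 1#
    a≈1 y with y ≟ ε
    ... | yes y≈ε = trans (a-cong y≈ε) a-ε
    ... | no y≉ε  = trans (a-const y≉ε γ≉ε) t≈1

  -- The constants κ and p relative to a base point γ, and the proof that p = 1

  module Nontrivial {γ} (γ≉ε : γ ≉ᴳ ε) where

    private
      f⁻¹ = proj₁ (inverse (f γ) (f≉0 γ≉ε))

    -- Opaque, because unfolding κ exposes the large proof that f γ ≉ 0.
    opaque
      κ : K.Carrier
      κ = F (γ ⁻¹) * f⁻¹

      F≈κf : ∀ {y} → y ≉ᴳ ε → F (y ⁻¹) ≈ κ * f y
      F≈κf {y} y≉ε = *-cancelˡ (f≉0 γ≉ε) (begin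
        f γ * F (y ⁻¹)                      ≈⟨ *-comm _ _ ⟩
        F (y ⁻¹) * f γ                      ≈⟨ F-proportional γ≉ε y≉ε ⟩
        F (γ ⁻¹) * f y                      ≈⟨ *-identityˡ _ ⟨
        1# * (F (γ ⁻¹) * f y)               ≈⟨ *-congʳ (proj₂ (inverse (f γ) (f≉0 γ≉ε))) ⟨
        f γ * f⁻¹ * (F (γ ⁻¹) * f y)
          ≈⟨ solve 4 (λ p q r t → p :* q :* (r :* t) := p :* (r :* q :* t)) refl _ _ _ _ ⟩
        f γ * (κ * f y)                     ∎)

    F≈κf⁻¹ : ∀ {y} → y ≉ᴳ ε → F y ≈ κ * f (y ⁻¹)
    F≈κf⁻¹ y≉ε = trans (F-cong (G.sym (⁻¹-involutive _))) (F≈κf (⁻¹-≉ε y≉ε))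

    κ≉0 : κ ≉ 0#
    κ≉0 κ≈0 = F≉0 (γ ⁻¹) (trans (F≈κf γ≉ε) (trans (*-congʳ κ≈0) (zeroˡ _)))

    -- Since F(y) = κ f(-y), the product F(y) F(-y) equals κ² a(y) p(y), so `F-norm` compares `p y`
    -- with `p γ`.
    p-const : ∀ {y} → y ≉ᴳ ε → p y ≈ p γ
    p-const {y} y≉ε = *-cancelˡ (*-≉0 (*-≉0 κ≉0 κ≉0) (*-≉0 (a≉0 y) (a≉0 γ))) (begin
      κ * κ * (a y * a γ) * p y
        ≈⟨ solve 5 (λ k ay aγ e e′ → k :* k :* (ay :* aγ) :* (e :* e′ :* ay) :=
             k :* (ay :* e′) :* (k :* (ay :* e)) :* aγ) refl _ _ _ _ _ ⟩
      κ * (a y * E (y ⁻¹)) * (κ * f y) * a γ      ≈⟨ *-congʳ (norm y≉ε) ⟩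
      F y * F (y ⁻¹) * a γ                        ≈⟨ F-norm y≉ε γ≉ε ⟩
      F γ * F (γ ⁻¹) * a y                        ≈⟨ *-congʳ (norm γ≉ε) ⟨
      κ * (a γ * E (γ ⁻¹)) * (κ * f γ) * a y
        ≈⟨ solve 5 (λ k ay aγ e e′ → k :* (aγ :* e′) :* (k :* (aγ :* e)) :* ay :=
             k :* k :* (ay :* aγ) :* (e :* e′ :* aγ)) refl _ _ _ _ _ ⟩
      κ * κ * (a y * a γ) * p γ                   ∎)
      where
      norm : ∀ {y} → y ≉ᴳ ε → κ * (a y * E (y ⁻¹)) * (κ * f y) ≈ F y * F (y ⁻¹)
      norm {y} y≉ε = sym (*-cong (trans (F≈κf⁻¹ y≉ε) (*-congˡ (*-congʳ (sym (a-even y))))) (F≈κf y≉ε))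

    p≉0 : p γ ≉ 0#
    p≉0 = *-≉0 (*-≉0 (E≉0 γ≉ε) (E≉0 (⁻¹-≉ε γ≉ε))) (a≉0 γ)

    -- This is `fourier-≉ε` at y = 0: there H is `a α` times the transform of `p`, and `F α` occurs
    -- on both sides.
    p-fourier : ∀ {α} → α ≉ᴳ ε → ∑ (λ z → p z * b z α) ≈ s * E ε
    p-fourier {α} α≉ε = *-cancelˡ (*-≉0 (a≉0 α) (F≉0 α)) (begin
      a α * F α * ∑ (λ z → p z * b z α)
        ≈⟨ trans (*-congʳ (*-comm _ _)) (*-assoc _ _ _) ⟩
      F α * (a α * ∑ (λ z → p z * b z α))
        ≈⟨ *-congˡ (trans (*-∑ _ _) (∑-cong summand)) ⟩
      F α * H ε α
        ≈⟨ fourier-≉ε α≉ε ε ⟨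
      s * a α * E ε * F (α ∙ ε)
        ≈⟨ *-congˡ (F-cong (G.identityʳ α)) ⟩
      s * a α * E ε * F α
        ≈⟨ solve 4 (λ s a e f → s :* a :* e :* f := a :* f :* (s :* e)) refl _ _ _ _ ⟩
      a α * F α * (s * E ε) ∎)
      where
      summand : ∀ z → a α * (p z * b z α) ≈ E (ε - z) * E z * a (z ∙ α)
      summand z = begin
        a α * (E z * E (z ⁻¹) * a z * b z α)
          ≈⟨ solve 5 (λ p e f r q → p :* (e :* f :* r :* q) := f :* e :* (r :* p :* q)) refl _ _ _ _ _ ⟩
        E (z ⁻¹) * E z * (a z * a α * b z α)
          ≈⟨ *-cong (*-congʳ (E-cong (G.sym (G.identityˡ _)))) (sym (a-∙ z α)) ⟩
        E (ε - z) * E z * a (z ∙ α) ∎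

    -- As `p` equals `p γ` off 0 and `D γ` vanishes, the transform of `p` at γ is p(0) - p(γ), where
    -- p(0) = E(0)². Compare with `p-fourier`.
    E-ε² : E ε * E ε ≈ p γ + s * E ε
    E-ε² = begin
      E ε * E ε                               ≈⟨ *-identityʳ _ ⟨
      E ε * E ε * 1#                          ≈⟨ *-cong (*-congˡ (E-cong ε⁻¹≈ε)) a-ε ⟨
      p ε                                     ≈⟨ *-identityʳ _ ⟨
      p ε * 1#                                ≈⟨ *-congˡ (b-εˡ γ) ⟨
      p ε * b ε γ                             ≈⟨ +-identityˡ _ ⟨
      0# + p ε * b ε γ                        ≈⟨ +-congʳ (trans (*-congˡ (D-≉ε γ≉ε)) (zeroʳ _)) ⟨
      p γ * D γ + p ε * b ε γ                 ≈⟨ +-congʳ (*-∑ _ _) ⟩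
      ∑ (λ z → p γ * b z γ) + p ε * b ε γ
        ≈⟨ ∑-agree _ _ (λ eq → *-cong (p-cong eq) (b-cong eq G.refl)) (λ eq → *-congˡ (b-cong eq G.refl)) ε
             (λ z z≉ε → *-congʳ (p-const z≉ε)) ⟨
      ∑ (λ z → p z * b z γ) + p γ * b ε γ
        ≈⟨ +-cong (p-fourier γ≉ε) (trans (*-congˡ (b-εˡ γ)) (*-identityʳ _)) ⟩
      s * E ε + p γ                           ≈⟨ +-comm _ _ ⟩
      p γ + s * E ε                           ∎

    private
      f̂ : A → K.Carrier
      f̂ β = ∑ λ z → f z * b z β

    -- Off 0 the product `E y * F y` is `κ * p y`, whose transform is known; the other terms correct
    -- the value at 0.
    ∑-bEF : ∀ {β} → β ≉ᴳ ε →
      ∑ (λ y → b y β * (E y * F y)) + κ * (E ε * E ε) ≈ κ * (s * E ε) + E ε * F ε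
    ∑-bEF {β} β≉ε = begin
      ∑ (λ y → b y β * (E y * F y)) + κ * (E ε * E ε)
        ≈⟨ +-congˡ at-ε ⟨
      ∑ (λ y → b y β * (E y * F y)) + κ * (p ε * b ε β)
        ≈⟨ ∑-agree _ _ (λ eq → *-cong (b-cong eq G.refl) (*-cong (E-cong eq) (F-cong eq)))
             (λ eq → *-congˡ (*-cong (p-cong eq) (b-cong eq G.refl))) ε away ⟩
      ∑ (λ y → κ * (p y * b y β)) + b ε β * (E ε * F ε)
        ≈⟨ +-cong (trans (sym (*-∑ _ _)) (*-congˡ (p-fourier β≉ε))) (trans (*-congʳ (b-εˡ β)) (*-identityˡ _)) ⟩
      κ * (s * E ε) + E ε * F ε ∎
      where
      at-ε : κ * (p ε * b ε β) ≈ κ * (E ε * E ε)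
      at-ε = *-congˡ (begin
        E ε * E (ε ⁻¹) * a ε * b ε β  ≈⟨ *-cong (*-cong (*-congˡ (E-cong ε⁻¹≈ε)) a-ε) (b-εˡ β) ⟩
        E ε * E ε * 1# * 1#           ≈⟨ trans (*-identityʳ _) (*-identityʳ _) ⟩
        E ε * E ε                     ∎)

      away : ∀ y → y ≉ᴳ ε → b y β * (E y * F y) ≈ κ * (p y * b y β)
      away y y≉ε = begin
        b y β * (E y * F y)                 ≈⟨ *-congˡ (*-congˡ (F≈κf⁻¹ y≉ε)) ⟩
        b y β * (E y * (κ * f (y ⁻¹)))
          ≈⟨ solve 4 (λ b e k f → b :* (e :* (k :* f)) := k :* (f :* e :* b)) refl _ _ _ _ ⟩
        κ * (f (y ⁻¹) * E y * b y β)        ≈⟨ *-congˡ (*-congʳ (p≈f*E y)) ⟨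
        κ * (p y * b y β)                   ∎

    -- `H y ε` is the convolution of `E` and `f`.
    ∑-bH : ∀ β → ∑ (λ y → b y β * H y ε) ≈ F β * f̂ β
    ∑-bH β = begin
      ∑ (λ y → b y β * H y ε)
        ≈⟨ ∑-cong (λ y → *-∑ _ _) ⟩
      ∑ (λ y → ∑ (λ z → b y β * (E (y - z) * E z * a (z ∙ ε))))
        ≈⟨ ∑-swap _ ⟩
      ∑ (λ z → ∑ (λ y → b y β * (E (y - z) * E z * a (z ∙ ε))))
        ≈⟨ ∑-cong inner ⟩
      ∑ (λ z → F β * (f z * b z β))
        ≈⟨ *-∑ _ _ ⟨
      F β * f̂ β ∎
      where
      inner : ∀ z → ∑ (λ y → b y β * (E (y - z) * E z * a (z ∙ ε))) ≈ F β * (f z * b z β)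
      inner z = begin
        ∑ (λ y → b y β * (E (y - z) * E z * a (z ∙ ε)))
          ≈⟨ ∑-cong (λ y → trans (*-congˡ (*-congˡ (a-cong (G.identityʳ z))))
               (solve 4 (λ b e e′ a → b :* (e :* e′ :* a) := a :* e′ :* (b :* e)) refl _ _ _ _)) ⟩
        ∑ (λ y → f z * (b y β * E (y - z)))   ≈⟨ *-∑ _ _ ⟨
        f z * ∑ (λ y → b y β * E (y - z))     ≈⟨ *-congˡ (F-shift β z) ⟩
        f z * (b z β * F β)                   ≈⟨ trans (sym (*-assoc _ _ _)) (*-comm _ _) ⟩
        F β * (f z * b z β)                   ∎

    F-inversion : ∀ β → ∑ (λ y → F (y ⁻¹) * b y β) ≈ E β * (s * s)
    F-inversion β = begin
      ∑ (λ y → F (y ⁻¹) * b y β)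
        ≈⟨ ∑-cong (λ y → ∑-* _ _) ⟩
      ∑ (λ y → ∑ (λ x → b x (y ⁻¹) * E x * b y β))
        ≈⟨ ∑-swap _ ⟩
      ∑ (λ x → ∑ (λ y → b x (y ⁻¹) * E x * b y β))
        ≈⟨ ∑-cong (λ x → trans (∑-cong (summand x)) (sym (*-∑ _ _))) ⟩
      ∑ (λ x → E x * D (β - x))
        ≈⟨ ∑-single _ (λ eq → *-cong (E-cong eq) (D-cong (//-cong₂ G.refl eq))) β
             (λ x x≉β → trans (*-congˡ (D-≉ε λ eq → x≉β (G.sym (x∙y⁻¹≈ε⇒x≈y β x eq)))) (zeroʳ _)) ⟩
      E β * D (β - β)
        ≈⟨ *-congˡ (trans (D-cong (G.inverseʳ β)) D-ε) ⟩
      E β * (s * s) ∎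
      where
      D-cong : ∀ {x y} → x ≈ᴳ y → D x ≈ D y
      D-cong eq = ∑-cong λ x → b-cong G.refl eq

      b-transpose : ∀ x y → b x (y ⁻¹) ≈ b y (x ⁻¹)
      b-transpose x y = *-cancelˡ (b≉0 x y) (trans (b-⁻¹ʳ x y)
        (trans (sym (b-⁻¹ʳ y x)) (*-congʳ (b-comm y x))))

      summand : ∀ x y → b x (y ⁻¹) * E x * b y β ≈ E x * b y (β - x)
      summand x y = begin
        b x (y ⁻¹) * E x * b y β      ≈⟨ *-congʳ (*-congʳ (b-transpose x y)) ⟩
        b y (x ⁻¹) * E x * b y β
          ≈⟨ solve 3 (λ p e q → p :* e :* q := e :* (q :* p)) refl _ _ _ ⟩
        E x * (b y β * b y (x ⁻¹))    ≈⟨ *-congˡ (b-homoʳ y β (x ⁻¹)) ⟨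
        E x * b y (β - x)             ∎

    κf̂ : ∀ β → E β * (s * s) + κ * E ε ≈ κ * f̂ β + F ε
    κf̂ β = begin
      E β * (s * s) + κ * E ε
        ≈⟨ +-cong (F-inversion β) (*-congˡ f-ε) ⟨
      ∑ (λ y → F (y ⁻¹) * b y β) + κ * (f ε * b ε β)
        ≈⟨ ∑-agree _ _ (λ eq → *-cong (F-cong (G.⁻¹-cong eq)) (b-cong eq G.refl))
             (λ eq → *-congˡ (*-cong (f-cong eq) (b-cong eq G.refl))) ε
             (λ y y≉ε → trans (*-congʳ (F≈κf y≉ε)) (*-assoc _ _ _)) ⟩
      ∑ (λ y → κ * (f y * b y β)) + F (ε ⁻¹) * b ε β
        ≈⟨ +-cong (sym (*-∑ _ _)) (trans (*-cong (F-cong ε⁻¹≈ε) (b-εˡ β)) (*-identityʳ _)) ⟩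
      κ * f̂ β + F ε ∎
      where
      f-ε : f ε * b ε β ≈ E ε
      f-ε = trans (*-cong (trans (*-congʳ a-ε) (*-identityˡ _)) (b-εˡ β)) (*-identityʳ _)

    ∑-fourier-ε : ∀ {β} → β ≉ᴳ ε → s * ∑ (λ y → b y β * (E y * F y)) ≈ F ε * (F β * f̂ β)
    ∑-fourier-ε {β} β≉ε = begin
      s * ∑ (λ y → b y β * (E y * F y))
        ≈⟨ *-∑ _ _ ⟩
      ∑ (λ y → s * (b y β * (E y * F y)))
        ≈⟨ ∑-cong (λ y → trans
             (solve 4 (λ s b e f → s :* (b :* (e :* f)) := b :* (s :* e :* f)) refl _ _ _ _)
             (trans (*-congˡ (fourier-ε y))
             (solve 4 (λ b c f h → b :* (c :+ f :* h) := c :* b :+ f :* (b :* h)) refl _ _ _ _))) ⟩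
      ∑ (λ y → c * (s * s) * b y β + F ε * (b y β * H y ε))
        ≈⟨ ∑-+ _ _ ⟩
      ∑ (λ y → c * (s * s) * b y β) + ∑ (λ y → F ε * (b y β * H y ε))
        ≈⟨ +-cong (trans (sym (*-∑ _ _)) (trans (*-congˡ (D-≉ε β≉ε)) (zeroʳ _)))
                  (trans (sym (*-∑ _ _)) (*-congˡ (∑-bH β))) ⟩
      0# + F ε * (F β * f̂ β)
        ≈⟨ +-identityˡ _ ⟩
      F ε * (F β * f̂ β) ∎

    -- The Fourier transform at β of fourier-ε.  Unless F ε ≈ κ E ε, it makes f constant
    -- away from ε.
    relation : ∀ {β} → β ≉ᴳ ε →
      F ε * (s * s) * p γ + F ε * (κ * E ε) * f (β ⁻¹) + s * κ * (E ε * E ε) ≈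
      s * s * (κ * E ε) + s * E ε * F ε + F ε * F ε * f (β ⁻¹)
    relation {β} β≉ε = begin
      F ε * (s * s) * p γ + F ε * (κ * E ε) * X + s * κ * (E ε * E ε)
        -- Writing the constant as `p β`, that is as `X * E β`, brings in `E β`, which `κf̂` trades
        -- for the transform of `f`.
        ≈⟨ +-congʳ (+-congʳ (*-congˡ (trans (sym (p-const β≉ε)) (p≈f*E β)))) ⟩
      F ε * (s * s) * (X * E β) + F ε * (κ * E ε) * X + s * κ * (E ε * E ε)
        ≈⟨ solve 6 (λ F s X eβ k e →
             F :* (s :* s) :* (X :* eβ) :+ F :* (k :* e) :* X :+ s :* k :* (e :* e) :=
             F :* X :* (eβ :* (s :* s) :+ k :* e) :+ s :* (k :* (e :* e))) refl _ _ _ _ _ _ ⟩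
      F ε * X * (E β * (s * s) + κ * E ε) + s * (κ * (E ε * E ε))
        ≈⟨ +-congʳ (*-congˡ (κf̂ β)) ⟩
      F ε * X * (κ * f̂ β + F ε) + s * (κ * (E ε * E ε))
        ≈⟨ solve 5 (λ F X k g t →
             F :* X :* (k :* g :+ F) :+ t := F :* (k :* X :* g) :+ t :+ F :* F :* X) refl _ _ _ _ _ ⟩
      F ε * (κ * X * f̂ β) + s * (κ * (E ε * E ε)) + F ε * F ε * X
        ≈⟨ +-congʳ (+-congʳ (trans (*-congˡ (*-congʳ (sym (F≈κf⁻¹ β≉ε)))) (sym (∑-fourier-ε β≉ε)))) ⟩
      s * ∑ (λ y → b y β * (E y * F y)) + s * (κ * (E ε * E ε)) + F ε * F ε * X
        ≈⟨ +-congʳ (trans (sym (distribˡ _ _ _)) (*-congˡ (∑-bEF β≉ε))) ⟩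
      s * (κ * (s * E ε) + E ε * F ε) + F ε * F ε * X
        ≈⟨ solve 5 (λ s k e F Y → s :* (k :* (s :* e) :+ e :* F) :+ Y :=
             s :* s :* (k :* e) :+ s :* e :* F :+ Y) refl _ _ _ _ _ ⟩
      s * s * (κ * E ε) + s * E ε * F ε + F ε * F ε * X ∎
      where X = f (β ⁻¹)

    -- The two terms with `f (γ ⁻¹)` in `relation` become equal, and so do the two that are linear
    -- in `s`. What is left is `F ε * (s * s)` times the claim.
    proportional⇒p≈1 : κ * E ε ≈ F ε → p γ ≈ 1#
    proportional⇒p≈1 κE≈F = *-cancelˡ (*-≉0 F-ε≉0 (*-≉0 s≉0 s≉0))
      (+-cancelʳ (F ε * F ε * X + s * E ε * F ε) (begin
        F ε * (s * s) * p γ + (F ε * F ε * X + s * E ε * F ε)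
          ≈⟨ +-congˡ (+-cong (*-congʳ (*-congˡ κE≈F)) sκEE) ⟨
        F ε * (s * s) * p γ + (F ε * (κ * E ε) * X + s * κ * (E ε * E ε))
          ≈⟨ +-assoc _ _ _ ⟨
        F ε * (s * s) * p γ + F ε * (κ * E ε) * X + s * κ * (E ε * E ε)
          ≈⟨ relation γ≉ε ⟩
        s * s * (κ * E ε) + s * E ε * F ε + F ε * F ε * X
          ≈⟨ +-congʳ (+-congʳ (trans (*-congˡ κE≈F) (trans (*-comm _ _) (sym (*-identityʳ _))))) ⟩
        F ε * (s * s) * 1# + s * E ε * F ε + F ε * F ε * X
          ≈⟨ trans (+-assoc _ _ _) (+-congˡ (+-comm _ _)) ⟩
        F ε * (s * s) * 1# + (F ε * F ε * X + s * E ε * F ε) ∎))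
      where
      X : K.Carrier
      X = f (γ ⁻¹)

      sκEE : s * κ * (E ε * E ε) ≈ s * E ε * F ε
      sκEE = begin
        s * κ * (E ε * E ε)
          ≈⟨ solve 3 (λ s k e → s :* k :* (e :* e) := s :* e :* (k :* e)) refl s κ (E ε) ⟩
        s * E ε * (κ * E ε)
          ≈⟨ *-congˡ κE≈F ⟩
        s * E ε * F ε ∎

    -- Otherwise `relation` has a single solution `f (β ⁻¹)`, the same for all β ≠ 0. Then p a(x) =
    -- f(-x) f(x) is constant off 0, and so is `a`.
    proportional : 3 ℕ.< n → κ * E ε ≈ F ε
    proportional 3<n with ≈0? (κ * E ε K.- F ε)
    ... | yes κE-F≈0 = RingProperties.x∙y⁻¹≈ε⇒x≈y ring _ _ κE-F≈0
    ... | no κE-F≉0 = ⊥-elim (a-nonconstant 3<n γ≉ε a-const)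
      where
      FκE≉FF : F ε * (κ * E ε) ≉ F ε * F ε
      FκE≉FF eq = κE-F≉0 (trans (+-congʳ (*-cancelˡ F-ε≉0 eq)) (-‿inverseʳ _))

      f⁻¹-const : ∀ {x y} → x ≉ᴳ ε → y ≉ᴳ ε → f (x ⁻¹) ≈ f (y ⁻¹)
      f⁻¹-const x≉ε y≉ε = crossed FκE≉FF (exchange (relation x≉ε) (relation y≉ε))

      f-const : ∀ {x y} → x ≉ᴳ ε → y ≉ᴳ ε → f x ≈ f y
      f-const {x} {y} x≉ε y≉ε = trans (f-cong (G.sym (⁻¹-involutive x)))
        (trans (f⁻¹-const (⁻¹-≉ε x≉ε) (⁻¹-≉ε y≉ε)) (f-cong (⁻¹-involutive y)))

      pa≈ff : ∀ {x} → x ≉ᴳ ε → p γ * a x ≈ f γ * f γ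
      pa≈ff {x} x≉ε = begin
        p γ * a x                  ≈⟨ *-congʳ (trans (sym (p-const x≉ε)) (p≈f*E x)) ⟩
        f (x ⁻¹) * E x * a x       ≈⟨ trans (*-assoc _ _ _) (*-congˡ (*-comm _ _)) ⟩
        f (x ⁻¹) * f x             ≈⟨ *-cong (f-const (⁻¹-≉ε x≉ε) γ≉ε) (f-const x≉ε γ≉ε) ⟩
        f γ * f γ                  ∎

      a-const : ∀ {x y} → x ≉ᴳ ε → y ≉ᴳ ε → a x ≈ a y
      a-const x≉ε y≉ε = *-cancelˡ p≉0 (trans (pa≈ff x≉ε) (sym (pa≈ff y≉ε)))

    p≈1 : p γ ≈ 1#
    p≈1 with n ℕ.≤? 4
    -- `E-ε²` and the extra requirement both express E(0)²; comparing them leaves p = 1.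
    ... | yes n≤4 = +-cancelʳ (s * E ε)
      (trans (sym E-ε²) (trans (small-order n≤4) (+-comm _ _)))
    ... | no n≰4 = proportional⇒p≈1 (proportional (ℕ.<-trans (ℕ.n<1+n 3) (ℕ.≰⇒> n≰4)))

  -- The base point of `Nontrivial` is `y` itself.
  inversion : ∀ {y} → y ≉ᴳ ε → E y * E (y ⁻¹) * a y ≈ 1#
  inversion = Nontrivial.p≈1

  E-ε-quadratic : E ε * E ε ≈ s * E ε + 1#
  E-ε-quadratic with n ℕ.≤? 4
  ... | yes n≤4 = small-order n≤4
  -- Only some non-zero element is wanted, hence `ε` three times.
  ... | no n≰4 with avoid (ℕ.<-trans (ℕ.n<1+n 3) (ℕ.≰⇒> n≰4)) ε ε ε
  ...   | γ , γ≉ε , _ = trans (Nontrivial.E-ε² γ≉ε) (trans (+-congʳ (inversion γ≉ε)) (+-comm _ _))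

  -- No x ≠ 0 equals -x, so the non-zero elements fall into pairs {x, -x}. `h` keeps `q` on the
  -- member with the smaller index and is 0 elsewhere. Its possible values are recorded because they
  -- suffice to bound the valuation of its sum.
  even-sum : ∀ q → (∀ {x y} → x ≈ᴳ y → q x ≈ q y) → (∀ x → q (x ⁻¹) ≈ q x) →
    ∃[ h ] (∀ x → h x ≈ 0# ⊎ h x ≈ q x) × ∑ q ≈ q ε + (∑ h + ∑ h)
  even-sum q q-cong q-even = h , h-values , (begin
    ∑ q                                    ≈⟨ +-identityʳ _ ⟨
    ∑ q + 0#
      ≈⟨ +-congˡ (trans (+-cong h-ε (trans (h-cong ε⁻¹≈ε) h-ε)) (+-identityˡ 0#)) ⟨
    ∑ q + (h ε + h (ε ⁻¹))
      ≈⟨ ∑-agree _ _ q-cong (λ eq → +-cong (h-cong eq) (h-cong (G.⁻¹-cong eq))) ε split ⟩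
    ∑ (λ x → h x + h (x ⁻¹)) + q ε         ≈⟨ +-comm _ _ ⟩
    q ε + ∑ (λ x → h x + h (x ⁻¹))
      ≈⟨ +-congˡ (trans (∑-+ _ _) (+-congˡ (sym (∑-permute h h-cong negation)))) ⟩
    q ε + (∑ h + ∑ h)                      ∎)
    where
    index : A → Fin n
    index = Inverse.from enumeration

    index-cong : ∀ {x y} → x ≈ᴳ y → index x ≡.≡ index y
    index-cong eq = Inverse.from-cong enumeration eq

    select : ∀ {x} → Dec (index x Fin.< index (x ⁻¹)) → K.Carrier
    select {x} (yes _) = q x
    select     (no _)  = 0#

    h : A → K.Carrier
    h x = select (index x Fin.<? index (x ⁻¹))

    h-values : ∀ x → h x ≈ 0# ⊎ h x ≈ q x
    h-values x with index x Fin.<? index (x ⁻¹)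
    ... | yes _ = inj₂ refl
    ... | no _  = inj₁ refl

    h-cong : ∀ {x y} → x ≈ᴳ y → h x ≈ h y
    h-cong {x} {y} eq with index x Fin.<? index (x ⁻¹) | index y Fin.<? index (y ⁻¹)
    ... | yes _ | yes _ = q-cong eq
    ... | no _  | no _  = refl
    ... | yes x< | no y≮ = contradiction
      (≡.subst₂ Fin._<_ (index-cong eq) (index-cong (G.⁻¹-cong eq)) x<) y≮
    ... | no x≮ | yes y< = contradiction
      (≡.subst₂ Fin._<_ (index-cong (G.sym eq)) (index-cong (G.⁻¹-cong (G.sym eq))) y<) x≮

    h-ε : h ε ≈ 0#
    h-ε with index ε Fin.<? index (ε ⁻¹)
    ... | yes ε< = contradiction (≡.sym (index-cong ε⁻¹≈ε)) (Fin.<⇒≢ ε<)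
    ... | no _   = refl

    split : ∀ x → x ≉ᴳ ε → q x ≈ h x + h (x ⁻¹)
    split x x≉ε with index x Fin.<? index (x ⁻¹) | index (x ⁻¹) Fin.<? index (x ⁻¹ ⁻¹)
    ... | yes _ | no _ = sym (+-identityʳ _)
    ... | no _ | yes _ = sym (trans (+-identityˡ _) (q-even x))
    ... | yes x< | yes x> = contradiction
      (≡.subst (index (x ⁻¹) Fin.<_) (index-cong (⁻¹-involutive x)) x>) (Fin.<-asym x<)
    ... | no x≮ | no x≯ with Fin.<-cmp (index x) (index (x ⁻¹))
    ...   | tri< x< _ _ = contradiction x< x≮
    ...   | tri> _ _ x> = contradiction
      (≡.subst (index (x ⁻¹) Fin.<_) (≡.sym (index-cong (⁻¹-involutive x))) x>) x≯
    ...   | tri≈ _ x≡ _ = contradiction (odd x (G.trans (G.∙-congˡ x≈x⁻¹) (G.inverseʳ x))) x≉ε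
      where
      x≈x⁻¹ : x ≈ᴳ x ⁻¹
      x≈x⁻¹ = G.trans (G.sym (Inverse.strictlyInverseˡ enumeration x)) (Inverse.inverseˡ enumeration x≡)

  opaque
    -- The sum H (2u) (−u) is invariant under z ↦ 2u − z, which fixes only z = u.
    doubling : ∀ {u} → u ≉ᴳ ε →
      ∃[ h ] (∀ w → h w ≈ 0# ⊎ h w ≈ E (u - w) * E (w ∙ u) * a w) ×
        s * E (u ∙ u) ≈ E u * E u * (E u * E u + (∑ h + ∑ h))
    doubling {u} u≉ε with even-sum q q-cong q-even
      where
      q : A → K.Carrier
      q w = E (u - w) * E (w ∙ u) * a w
      q-cong : ∀ {x y} → x ≈ᴳ y → q x ≈ q y
      q-cong eq = *-cong (*-cong (E-cong (//-cong₂ G.refl eq)) (E-cong (G.∙-congʳ eq))) (a-cong eq)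
      q-even : ∀ x → q (x ⁻¹) ≈ q x
      q-even x = *-cong (trans (*-comm _ _)
        (*-cong (E-cong (G.comm _ _)) (E-cong (G.trans (G.∙-congˡ (⁻¹-involutive x)) (G.comm _ _)))))
        (sym (a-even x))
    ... | h , h-values , ∑q≈ = h , h-values , (begin
      s * E (u ∙ u)
        ≈⟨ *-identityʳ _ ⟨
      s * E (u ∙ u) * 1#
        ≈⟨ *-congˡ (inversion u≉ε) ⟨
      s * E (u ∙ u) * (E u * E (u ⁻¹) * a u)
        ≈⟨ *-cancelˡ (*-≉0 κ≉0 (a≉0 u)) sE≈ ⟩
      E u * E u * H (u ∙ u) (u ⁻¹)
        ≈⟨ *-congˡ (trans H≈∑ (trans ∑q≈ (+-congʳ q-ε))) ⟩
      E u * E u * (E u * E u + (∑ h + ∑ h)) ∎)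
      where
      open Nontrivial u≉ε

      -- The substitution z = w + u moves the fixed point of the involution to w = 0, the form that
      -- `even-sum` expects.
      H≈∑ : H (u ∙ u) (u ⁻¹) ≈ ∑ (λ w → E (u - w) * E (w ∙ u) * a w)
      H≈∑ = trans
        (∑-permute _ (λ eq → *-cong (*-cong (E-cong (//-cong₂ G.refl eq)) (E-cong eq)) (a-cong (G.∙-congʳ eq)))
          (translation u))
        (∑-cong λ w → *-cong (*-congʳ (E-cong ([x∙z]-[y∙z]≈x-y u w u))) (a-cong (//-rightDividesʳ u w)))

      q-ε : E (u - ε) * E (ε ∙ u) * a ε ≈ E u * E u
      q-ε = trans (*-cong (*-cong (E-cong (G.trans (G.∙-congˡ ε⁻¹≈ε) (G.identityʳ u))) (E-cong (G.identityˡ u))) a-ε)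
        (*-identityʳ _)

      -- This is `fourier-≉ε` at α = -u and y = 2u, multiplied by `E u`, after replacing F(u) by κ
      -- f(-u) and F(-u) by κ f(u).
      sE≈ : κ * a u * (s * E (u ∙ u) * (E u * E (u ⁻¹) * a u)) ≈ κ * a u * (E u * E u * H (u ∙ u) (u ⁻¹))
      sE≈ = begin
        κ * a u * (s * E (u ∙ u) * (E u * E (u ⁻¹) * a u))
          ≈⟨ solve 6 (λ k a s e₂ e e′ → k :* a :* (s :* e₂ :* (e :* e′ :* a)) :=
               e :* (s :* a :* e₂ :* (k :* (a :* e′)))) refl _ _ _ _ _ _ ⟩
        E u * (s * a u * E (u ∙ u) * (κ * (a u * E (u ⁻¹))))
          ≈⟨ *-congˡ (*-cong (*-congʳ (*-congˡ (a-even u)))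
               (trans (*-congˡ (*-congʳ (a-even u))) (trans (sym (F≈κf⁻¹ u≉ε)) (F-cong (G.sym (x⁻¹∙[x∙y]≈y u u)))))) ⟩
        E u * (s * a (u ⁻¹) * E (u ∙ u) * F (u ⁻¹ ∙ (u ∙ u)))
          ≈⟨ *-congˡ (fourier-≉ε (⁻¹-≉ε u≉ε) (u ∙ u)) ⟩
        E u * (F (u ⁻¹) * H (u ∙ u) (u ⁻¹))
          ≈⟨ *-congˡ (*-congʳ (F≈κf u≉ε)) ⟩
        E u * (κ * (a u * E u) * H (u ∙ u) (u ⁻¹))
          ≈⟨ solve 4 (λ k a e h → e :* (k :* (a :* e) :* h) := k :* a :* (e :* e :* h)) refl _ _ _ _ ⟩
        κ * a u * (E u * E u * H (u ∙ u) (u ⁻¹)) ∎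

-- Valuations

module OrderedAbelianGroupProperties {g ℓ₁ ℓ₂} (Γ : OrderedAbelianGroup g ℓ₁ ℓ₂) where
  open OrderedAbelianGroup Γ
  private
    module E = AddSupremumEquality _≈_
    module O = AddSupremumOrder _≤_
  open IsDecTotalOrder (O.≤⁺-isDecTotalOrder isDecTotalOrder) public
    using () renaming
    ( refl to ≤⁺-refl; reflexive to ≤⁺-reflexive; trans to ≤⁺-trans; antisym to ≤⁺-antisym
    ; total to ≤⁺-total; _≟_ to _≈⁺?_; _≤?_ to _≤⁺?_ ; module Eq to ≈⁺)

  0⁺ : Carrier ⁺
  0⁺ = [ ε ]

  ∙⁺-comm : ∀ x y → x ∙⁺ y ≈⁺ y ∙⁺ x
  ∙⁺-comm [ x ] [ y ] = E.[ comm x y ]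
  ∙⁺-comm [ _ ] ⊤⁺    = ≈⁺.refl
  ∙⁺-comm ⊤⁺    [ _ ] = ≈⁺.refl
  ∙⁺-comm ⊤⁺    ⊤⁺    = ≈⁺.refl

  ∙⁺-identityˡ : ∀ x → 0⁺ ∙⁺ x ≈⁺ x
  ∙⁺-identityˡ [ x ] = E.[ identityˡ x ]
  ∙⁺-identityˡ ⊤⁺    = ≈⁺.refl

  ∙⁺-monoˡ : ∀ {x y} z → x ≤⁺ y → x ∙⁺ z ≤⁺ y ∙⁺ z
  ∙⁺-monoˡ [ z ] O.[ x≤y ]    = O.[ ∙-monoˡ-≤ z x≤y ]
  ∙⁺-monoˡ ⊤⁺    O.[ _ ]      = ≤⁺-refl
  ∙⁺-monoˡ z     (_ O.≤⊤⁺)    = _ O.≤⊤⁺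

  ∙⁺-monoʳ : ∀ x {y z} → y ≤⁺ z → x ∙⁺ y ≤⁺ x ∙⁺ z
  ∙⁺-monoʳ x y≤z = ≤⁺-trans (≤⁺-reflexive (∙⁺-comm x _))
    (≤⁺-trans (∙⁺-monoˡ x y≤z) (≤⁺-reflexive (∙⁺-comm _ x)))

  x≤y∙⁺x : ∀ x {y} → 0⁺ ≤⁺ y → x ≤⁺ y ∙⁺ x
  x≤y∙⁺x x 0≤y = ≤⁺-trans (≤⁺-reflexive (≈⁺.sym (∙⁺-identityˡ x))) (∙⁺-monoˡ x 0≤y)

  y∙⁺x≤x : ∀ x {y} → y ≤⁺ 0⁺ → y ∙⁺ x ≤⁺ x
  y∙⁺x≤x x y≤0 = ≤⁺-trans (∙⁺-monoˡ x y≤0) (≤⁺-reflexive (∙⁺-identityˡ x))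

  minimum : ∀ {n} (f : Vector (Carrier ⁺) (ℕ.suc n)) → ∃[ i ] ∀ j → f i ≤⁺ f j
  minimum {ℕ.zero} f = zero , λ { zero → ≤⁺-refl }
  minimum {ℕ.suc n} f with minimum (f ∘ suc)
  ... | i , f-min with ≤⁺-total (f zero) (f (suc i))
  ...   | inj₁ 0≤i = zero , λ { zero → ≤⁺-refl ; (suc j) → ≤⁺-trans 0≤i (f-min j) }
  ...   | inj₂ i≤0 = suc i , λ { zero → i≤0 ; (suc j) → f-min j }

module ValuationProperties {k ℓ g ℓ₁ ℓ₂} {K : CommutativeRing k ℓ} {Γ : OrderedAbelianGroup g ℓ₁ ℓ₂}
                           {V : Valuation K Γ} (extends : ExtendsTwoAdic V) where
  open CommutativeRing K hiding (zero)
  open Valuation V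
  open ExtendsTwoAdic extends
  open OrderedAbelianGroupProperties Γ
  private module Γ = OrderedAbelianGroup Γ
  open Γ using (_≤⁺_; _≈⁺_; _∙⁺_)
  private
    module E = AddSupremumEquality Γ._≈_
    module O = AddSupremumOrder Γ._≤_
    module Γ≤ = IsDecTotalOrder Γ.isDecTotalOrder
  open Exponentiation commutativeSemiring using (_^_; ^-congˡ; ^-distrib-*)

  -- Membership in the valuation ring and in its maximal ideal. As the order is total, the negated
  -- form of `Small` means a strictly positive valuation.
  Integral Small : Carrier → Set _
  Integral x = 0⁺ ≤⁺ v x
  Small x    = ¬ (v x ≤⁺ 0⁺)

  -- Source of every case distinction on vanishing in the algebraic part: the order of the value
  -- group is decidable, and only 0 has infinite valuation.
  ≈0? : ∀ x → Dec (x ≈ 0#)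
  ≈0? x = map′ (Equivalence.to (v-∞ x)) (Equivalence.from (v-∞ x)) (v x ≈⁺? ⊤⁺)

  2∤1 : Oddℤ (+ 1)
  2∤1 = ℕ.>⇒∤ (ℕ.s≤s (ℕ.s≤s ℕ.z≤n))

  v-1 : v 1# ≈⁺ 0⁺
  v-1 = ≈⁺.trans (v-ratio 0 0 (+ 1) (+ 1) 2∤1 2∤1 1# (*-identityʳ _)) E.[ Γ.inverseʳ Γ.ε ]

  1≉0 : 1# ≉ 0#
  1≉0 1≈0 with ≈⁺.trans (≈⁺.sym v-1) (Equivalence.from (v-∞ 1#) 1≈0)
  ... | ()

  -- This is where the residue characteristic 2 enters.
  small-2 : Small (1# + 1#)
  small-2 v2≤0 with ≤⁺-trans (≤⁺-reflexive (≈⁺.sym v-2)) v2≤0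
    where
    v-2 : v (1# + 1#) ≈⁺ [ 1Γ ]
    v-2 = ≈⁺.trans
      (v-ratio 1 0 (+ 1) (+ 1) 2∤1 2∤1 (1# + 1#)
        (trans (*-congʳ (+-identityʳ 1#)) (trans (*-identityˡ _) (+-congˡ (sym (+-identityʳ 1#))))))
      E.[ Γ.trans (Γ.∙-cong (Γ.identityʳ 1Γ) (AbelianGroupProperties.ε⁻¹≈ε Γ.abelianGroup)) (Γ.identityʳ 1Γ) ]
  ... | O.[ 1Γ≤0 ] = 1Γ-nonzero (Γ≤.antisym 1Γ≤0 1Γ-nonneg)

  integral-cong : ∀ {x y} → x ≈ y → Integral x → Integral y
  integral-cong x≈y 0≤vx = ≤⁺-trans 0≤vx (≤⁺-reflexive (v-cong x≈y))

  small-cong : ∀ {x y} → x ≈ y → Small x → Small y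
  small-cong x≈y vx≰0 vy≤0 = vx≰0 (≤⁺-trans (≤⁺-reflexive (v-cong x≈y)) vy≤0)

  integral-+ : ∀ {x y} → Integral x → Integral y → Integral (x + y)
  integral-+ {x} {y} ix iy with v-+ x y
  ... | inj₁ vx≤ = ≤⁺-trans ix vx≤
  ... | inj₂ vy≤ = ≤⁺-trans iy vy≤

  small-+ : ∀ {x y} → Small x → Small y → Small (x + y)
  small-+ {x} {y} sx sy v≤0 with v-+ x y
  ... | inj₁ vx≤ = sx (≤⁺-trans vx≤ v≤0)
  ... | inj₂ vy≤ = sy (≤⁺-trans vy≤ v≤0)

  v≤v-* : ∀ {x} y → Integral x → v y ≤⁺ v (x * y)
  v≤v-* {x} y ix = ≤⁺-trans (x≤y∙⁺x (v y) ix) (≤⁺-reflexive (≈⁺.sym (v-* x y)))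

  integral-* : ∀ {x y} → Integral x → Integral y → Integral (x * y)
  integral-* ix iy = ≤⁺-trans iy (v≤v-* _ ix)

  small-* : ∀ {x y} → Integral x → Small y → Small (x * y)
  small-* ix sy vxy≤0 = sy (≤⁺-trans (v≤v-* _ ix) vxy≤0)

  small⇒integral : ∀ {x} → Small x → Integral x
  small⇒integral {x} sx with ≤⁺-total 0⁺ (v x)
  ... | inj₁ 0≤vx = 0≤vx
  ... | inj₂ vx≤0 = contradiction vx≤0 sx

  integral-1 : Integral 1#
  integral-1 = ≤⁺-reflexive (≈⁺.sym v-1)

  integral-0 : Integral 0#
  integral-0 = ≤⁺-trans (_ O.≤⊤⁺) (≤⁺-reflexive (≈⁺.sym (Equivalence.from (v-∞ 0#) refl)))

  ¬small-1 : ¬ Small 1#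
  ¬small-1 s1 = s1 (≤⁺-reflexive v-1)

  small-inverse : ∀ {x y} → ¬ Integral x → x * y ≈ 1# → Small y
  small-inverse {x} {y} ¬ix xy≈1 vy≤0 = ¬ix (≤⁺-trans
    (≤⁺-reflexive (≈⁺.trans (≈⁺.sym v-1) (v-cong (trans (sym xy≈1) (*-comm x y)))))
    (≤⁺-trans (≤⁺-reflexive (v-* y x)) (y∙⁺x≤x (v x) vy≤0)))

  unit⇒v≈0 : ∀ {x y} → Integral x → Integral y → x * y ≈ 1# → v x ≈⁺ 0⁺
  unit⇒v≈0 {x} {y} ix iy xy≈1 = ≤⁺-antisym
    (≤⁺-trans (v≤v-* x iy) (≤⁺-reflexive (≈⁺.trans (v-cong (trans (*-comm y x) xy≈1)) v-1)))
    ix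

  integral-^ : ∀ m {x} → Integral x → Integral (x ^ m)
  integral-^ ℕ.zero    ix = integral-1
  integral-^ (ℕ.suc m) ix = integral-* ix (integral-^ m ix)

  ^-1 : ∀ m → 1# ^ m ≈ 1#
  ^-1 ℕ.zero    = refl
  ^-1 (ℕ.suc m) = trans (*-identityˡ _) (^-1 m)

  v-quotient : ∀ {x y z} → x * z ≈ 1# → v x ≤⁺ v y → Integral (z * y)
  v-quotient {x} {y} {z} xz≈1 vx≤vy = ≤⁺-trans
    (≤⁺-reflexive (≈⁺.trans (≈⁺.sym v-1) (≈⁺.trans (v-cong (trans (sym xz≈1) (*-comm x z))) (v-* z x))))
    (≤⁺-trans (∙⁺-monoʳ (v z) vx≤vy) (≤⁺-reflexive (≈⁺.sym (v-* z y))))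

  module _ (inverse : ∀ x → x ≉ 0# → ∃[ y ] x * y ≈ 1#) where

    ¬integral⇒≉0 : ∀ {x} → ¬ Integral x → x ≉ 0#
    ¬integral⇒≉0 ¬ix x≈0 = ¬ix (integral-cong (sym x≈0) integral-0)

    -- If v(x) < 0, the inverse y is small, so 1 is the product of an integral power of x and a
    -- small power of y, hence small.
    integral-root : ∀ m {x} → Integral (x ^ ℕ.suc m) → Integral x
    integral-root m {x} ixᵐ with 0⁺ ≤⁺? v x
    ... | yes ix = ix
    ... | no ¬ix with inverse x (¬integral⇒≉0 ¬ix)
    ...   | y , xy≈1 = contradiction (small-cong
      (trans (sym (^-distrib-* x y (ℕ.suc m))) (trans (^-congˡ (ℕ.suc m) xy≈1) (^-1 (ℕ.suc m))))
      (small-* ixᵐ (small-cong (*-comm _ _) (small-* (integral-^ m (small⇒integral sy)) sy)))) ¬small-1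
      where
      sy : Small y
      sy = small-inverse ¬ix xy≈1

-- Integrality of E from a value of minimal valuation

module Integrality {k ℓ g ℓg γ ℓ₁ ℓ₂} {K : CommutativeRing k ℓ} {G : AbelianGroup g ℓg} {n}
  (𝓔 : FieldDilogarithm K G n)
  {Γ : OrderedAbelianGroup γ ℓ₁ ℓ₂} {V : Valuation K Γ} (extends : ExtendsTwoAdic V)
  (integral-a : ∀ x → ValuationProperties.Integral extends (FieldDilogarithm.a 𝓔 x))
  (integral-s : ValuationProperties.Integral extends (FieldDilogarithm.s 𝓔)) where
  open CommutativeRing K renaming (_-_ to _−_) hiding (zero)
  open FieldDilogarithm 𝓔
  open FieldDilogarithmProperties 𝓔
  open ValuationProperties extends hiding (≈0?; 1≉0)
  open OrderedAbelianGroupProperties Γ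
  open OrderedAbelianGroup Γ using (_≤⁺_; _≈⁺_)
  open Valuation V
  open SemiringSolver commutativeSemiring using (solve; _:=_; _:+_; _:*_)
  private module G = AbelianGroup G
  open G using (_∙_; ε; _⁻¹; _-_) renaming (Carrier to A; _≈_ to _≈ᴳ_; _≉_ to _≉ᴳ_)
  open AbelianGroupProperties G using (ε⁻¹≈ε)
  open SetoidReasoning setoid

  integral-∑ : ∀ f → (∀ x → Integral (f x)) → Integral (∑ f)
  integral-∑ f if = integral-cong (sym (∑-sum f))
    (integral-sum (f ∘ Inverse.to enumeration) (if ∘ Inverse.to enumeration))
    where
    open RawMonoidDefinitions +-rawMonoid using (sum)
    integral-sum : ∀ {m} (f : Vector Carrier m) → (∀ i → Integral (f i)) → Integral (sum f)
    integral-sum {ℕ.zero}  f if = integral-0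
    integral-sum {ℕ.suc m} f if = integral-+ (if zero) (integral-sum (f ∘ suc) (if ∘ suc))

  -- A square root of 1 is integral.
  integral-neg1 : Integral (- 1#)
  integral-neg1 = integral-root inverse 1 (integral-cong (sym (begin
    - 1# * (- 1# * 1#)    ≈⟨ *-congˡ (*-identityʳ _) ⟩
    - 1# * - 1#           ≈⟨ RingProperties.-1*x≈-x ring (- 1#) ⟩
    - - 1#                ≈⟨ RingProperties.-‿involutive ring 1# ⟩
    1#                    ∎)) integral-1)

  minimal : ∃[ u ] ∀ z → v (E u) ≤⁺ v (E z)
  minimal = search enumeration
    where
    -- The size is generalised so that it can be matched as a successor; the empty case is refuted
    -- by the index of `ε`.
    search : ∀ {m} → Inverse (≡.setoid (Fin m)) G.setoid → ∃[ u ] ∀ z → v (E u) ≤⁺ v (E z)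
    search {ℕ.zero}  φ with () ← Inverse.from φ ε
    search {ℕ.suc m} φ with minimum (v ∘ E ∘ Inverse.to φ)
    ... | i , least = Inverse.to φ i , λ z → ≤⁺-trans (least (Inverse.from φ z))
      (≤⁺-reflexive (v-cong (E-cong (Inverse.strictlyInverseˡ φ z))))

  -- If v (E u) < 0 were minimal, dividing E(0)² = √N E(0) + 1 by E(u)², respectively
  -- √N E(2u) = E(u)² (E(u)² + 2X) by E(u)⁴, would give v(1) > 0.
  integral-minimum : ∀ {u} → (∀ z → v (E u) ≤⁺ v (E z)) → Integral (E u)
  integral-minimum {u} least with 0⁺ ≤⁺? v (E u)
  ... | yes iEu = iEu
  ... | no ¬iEu with inverse (E u) (¬integral⇒≉0 inverse ¬iEu)
  ...   | e , Ee≈1 = contradiction small-1 ¬small-1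
    where
    small-e : Small e
    small-e = small-inverse ¬iEu Ee≈1

    integral-e : Integral e
    integral-e = small⇒integral small-e

    integral-eE : ∀ z → Integral (e * E z)
    integral-eE z = v-quotient Ee≈1 (least z)

    ee*EE : e * e * (E u * E u) ≈ 1#
    ee*EE = begin
      e * e * (E u * E u)      ≈⟨ solve 2 (λ e E → e :* e :* (E :* E) := E :* e :* (E :* e)) refl e (E u) ⟩
      E u * e * (E u * e)      ≈⟨ *-cong Ee≈1 Ee≈1 ⟩
      1# * 1#                  ≈⟨ *-identityˡ 1# ⟩
      1#                       ∎

    small-1 : Small 1#
    small-1 with u ≟ ε
    ... | yes u≈ε = small-cong (begin
      s * e + e * e                       ≈⟨ +-congʳ (*-identityʳ _) ⟨
      s * e * 1# + e * e                  ≈⟨ +-congʳ (*-congˡ Ee≈1) ⟨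
      s * e * (E u * e) + e * e
        ≈⟨ +-cong (solve 3 (λ s e E → s :* e :* (E :* e) := e :* e :* (s :* E)) refl s e (E u))
                  (sym (*-identityʳ _)) ⟩
      e * e * (s * E u) + e * e * 1#      ≈⟨ distribˡ _ _ _ ⟨
      e * e * (s * E u + 1#)
        ≈⟨ *-congˡ (+-congʳ (*-congˡ (E-cong u≈ε))) ⟩
      e * e * (s * E ε + 1#)              ≈⟨ *-congˡ E-ε-quadratic ⟨
      e * e * (E ε * E ε)                 ≈⟨ *-congˡ (*-cong (E-cong u≈ε) (E-cong u≈ε)) ⟨
      e * e * (E u * E u)                 ≈⟨ ee*EE ⟩
      1#                                  ∎)
      (small-+ (small-* integral-s small-e) (small-* integral-e small-e))
    ... | no u≉ε with doubling u≉ε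
    ...   | h , h-values , sE≈ = small-cong (begin
      L + - 1# * M                ≈⟨ +-congʳ L≈1+M ⟩
      1# + M + - 1# * M           ≈⟨ +-congˡ (RingProperties.-1*x≈-x ring M) ⟩
      1# + M + - M                ≈⟨ trans (+-assoc _ _ _) (+-congˡ (-‿inverseʳ M)) ⟩
      1# + 0#                     ≈⟨ +-identityʳ 1# ⟩
      1#                          ∎)
      (small-+ small-L (small-* integral-neg1 small-M))
      where
      -- `L` is s E(2u) / E(u)⁴ and `M` is 2X / E(u)², so the doubling relation reads L = 1 + M. By
      -- minimality each value of `E` becomes integral after one factor `e`. In `L` three further
      -- factors `e` remain, which make it small; in `M` none remains, and only the factor 2 makes
      -- it small.
      L M : Carrier
      L = s * (e * E (u ∙ u)) * (e * e) * e
      M = ∑ (λ w → e * e * h w) * (1# + 1#)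

      small-L : Small L
      small-L = small-* (integral-* (integral-* integral-s (integral-eE (u ∙ u)))
                                    (integral-* integral-e integral-e)) small-e

      integral-h : ∀ w → Integral (e * e * h w)
      integral-h w with h-values w
      ... | inj₁ h≈0 = integral-cong (sym (trans (*-congˡ h≈0) (zeroʳ _))) integral-0
      ... | inj₂ h≈q = integral-cong (begin
        e * E (u - w) * (e * E (w ∙ u)) * a w
          ≈⟨ solve 4 (λ e p q a → e :* p :* (e :* q) :* a := e :* e :* (p :* q :* a)) refl _ _ _ _ ⟩
        e * e * (E (u - w) * E (w ∙ u) * a w)
          ≈⟨ *-congˡ h≈q ⟨
        e * e * h w ∎)
        (integral-* (integral-* (integral-eE (u - w)) (integral-eE (w ∙ u))) (integral-a w))

      small-M : Small M
      small-M = small-* (integral-∑ _ integral-h) small-2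

      L≈1+M : L ≈ 1# + M
      L≈1+M = begin
        s * (e * E (u ∙ u)) * (e * e) * e
          ≈⟨ solve 3 (λ s e d → s :* (e :* d) :* (e :* e) :* e := e :* e :* (e :* e) :* (s :* d))
               refl s e (E (u ∙ u)) ⟩
        e * e * (e * e) * (s * E (u ∙ u))
          ≈⟨ *-congˡ sE≈ ⟩
        e * e * (e * e) * (E u * E u * (E u * E u + (∑ h + ∑ h)))
          ≈⟨ solve 3 (λ p q r → p :* p :* (q :* (q :+ (r :+ r))) := p :* q :* (p :* q :+ (p :* r :+ p :* r)))
               refl (e * e) (E u * E u) (∑ h) ⟩
        e * e * (E u * E u) * (e * e * (E u * E u) + (e * e * ∑ h + e * e * ∑ h))
          ≈⟨ trans (*-congʳ ee*EE) (trans (*-identityˡ _) (+-congʳ ee*EE)) ⟩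
        1# + (e * e * ∑ h + e * e * ∑ h)
          ≈⟨ +-congˡ (+-cong (trans (*-∑ _ _) (sym (*-identityʳ _))) (trans (*-∑ _ _) (sym (*-identityʳ _)))) ⟩
        1# + (∑ (λ w → e * e * h w) * 1# + ∑ (λ w → e * e * h w) * 1#)
          ≈⟨ +-congˡ (distribˡ _ _ _) ⟨
        1# + M ∎

  integral-E : ∀ z → Integral (E z)
  integral-E z = ≤⁺-trans (integral-minimum (proj₂ minimal)) (proj₂ minimal z)

  v-E : ∀ u → v (E u) ≈⁺ 0⁺
  v-E u with u ≟ ε
  ... | no u≉ε  = unit⇒v≈0 (integral-E u) (integral-* (integral-E (u ⁻¹)) (integral-a u))
    (trans (sym (*-assoc _ _ _)) (inversion u≉ε))
  ... | yes u≈ε = unit⇒v≈0 (integral-E u) (integral-+ (integral-E ε) (integral-* integral-neg1 integral-s))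
    (begin
      E u * (E ε + - 1# * s)              ≈⟨ *-congʳ (E-cong u≈ε) ⟩
      E ε * (E ε + - 1# * s)              ≈⟨ distribˡ _ _ _ ⟩
      E ε * E ε + E ε * (- 1# * s)        ≈⟨ +-congʳ E-ε-quadratic ⟩
      s * E ε + 1# + E ε * (- 1# * s)
        ≈⟨ solve 4 (λ s e o m → s :* e :+ o :+ e :* (m :* s) := o :+ (s :* e :+ m :* (s :* e)))
             refl s (E ε) 1# (- 1#) ⟩
      1# + (s * E ε + - 1# * (s * E ε))
        ≈⟨ +-congˡ (trans (+-congˡ (RingProperties.-1*x≈-x ring _)) (-‿inverseʳ _)) ⟩
      1# + 0#                             ≈⟨ +-identityʳ 1# ⟩
      1#                                  ∎)

-- Orders of elements in a finite abelian group

module FiniteGroup {g ℓ n} (G : AbelianGroup g ℓ)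
                   (enumeration : Inverse (≡.setoid (Fin n)) (AbelianGroup.setoid G)) where
  open AbelianGroup G
  open AbelianGroupProperties G using (identityʳ-unique)
  open GroupIdentities G
  open RawMonoidDefinitions rawMonoid using () renaming (_×_ to _·_)
  open FiniteSetoid.Summation enumeration commutativeMonoid
  open SetoidReasoning setoid

  -- Translation by `x` permutes the group, and it adds `n · x` to the sum of all elements.
  lagrange : ∀ x → n · x ≈ ε
  lagrange x = identityʳ-unique (∑ id) (n · x) (begin
    ∑ id ∙ n · x              ≈⟨ ∙-congˡ (∑-const x) ⟨
    ∑ id ∙ ∑ (λ _ → x)        ≈⟨ ∑-∙ id (λ _ → x) ⟨
    ∑ (λ y → y ∙ x)           ≈⟨ ∑-permute id id (translation x) ⟨
    ∑ id                      ∎)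

  -- From `n · x ≈ ε` pairs of summands `x` are removed until a single one is left.
  odd⇒no-2-torsion : ¬ (2 ∣ n) → ∀ x → x ∙ x ≈ ε → x ≈ ε
  odd⇒no-2-torsion 2∤n x x²≈ε = descend n 2∤n (lagrange x)
    where
    descend : ∀ m → ¬ (2 ∣ m) → m · x ≈ ε → x ≈ ε
    descend 0               2∤m _    = contradiction (2 ℕ.∣0) 2∤m
    descend 1               2∤m mx≈ε = trans (sym (identityʳ x)) mx≈ε
    descend (ℕ.suc (ℕ.suc m)) 2∤m mx≈ε = descend m (2∤m ∘ ℕ.∣m∣n⇒∣m+n ℕ.∣-refl) (begin
      m · x                   ≈⟨ identityˡ _ ⟨
      ε ∙ m · x               ≈⟨ ∙-congʳ x²≈ε ⟨
      x ∙ x ∙ m · x           ≈⟨ assoc _ _ _ ⟩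
      x ∙ (x ∙ m · x)         ≈⟨ mx≈ε ⟩
      ε                       ∎)

-- Descent from ℂ to ℚ̄

module RootAlgebraic {c ℓ} (R : CommutativeRing c ℓ) where
  open CommutativeRing R
  open Exponentiation commutativeSemiring using (_^_)
  open RawMonoidDefinitions +-rawMonoid using () renaming (_×_ to _·_)

  private
    monomial : ℕ → List ℤ
    monomial ℕ.zero    = + 1 ∷ []
    monomial (ℕ.suc m) = 0ℤ ∷ monomial m

    evaluate-monomial : ∀ m y → evaluate R (monomial m) y ≈ y ^ m
    evaluate-monomial ℕ.zero    y = trans (+-cong (+-identityʳ 1#) (zeroʳ y)) (+-identityʳ 1#)
    evaluate-monomial (ℕ.suc m) y = trans (+-identityˡ _) (*-congˡ (evaluate-monomial m y))

  -- The polynomial is Y^(m+1) - (k+1). Since k+1 is a successor, its constant term is visibly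
  -- non-zero.
  root-algebraic : ∀ m k {y} → y ^ ℕ.suc m ≈ ℕ.suc k · 1# → Algebraic R y
  root-algebraic m k {y} yᵐ≈k = -[1+ k ] ∷ monomial m , here (λ ()) ,
    trans (+-congˡ (trans (*-congˡ (evaluate-monomial m y)) yᵐ≈k)) (-‿inverseˡ _)

module Descent {c ℓ₁ ℓ₂ d ℓ g ℓg}
  {ℝ : RealNumbers c ℓ₁ ℓ₂} (ℚ̄ : AlgebraicNumbers ℝ d ℓ)
  (G : MetricGroup ℝ g ℓg) (2∤N : ¬ (2 ∣ MetricGroup.order G))
  (√N : SquareRoot ℝ (MetricGroup.order G))
  (E : MetricGroup.Carrier G → AlgebraicNumbers.Carrier ℚ̄)
  (dilog : IsFiniteQuantumDilogarithm G √N (AlgebraicNumbers.embed ℚ̄ ∘ E))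
  (≈0? : ∀ x → Dec (AlgebraicNumbers._≈_ ℚ̄ x (AlgebraicNumbers.0# ℚ̄)))
  (1≉0 : ¬ AlgebraicNumbers._≈_ ℚ̄ (AlgebraicNumbers.1# ℚ̄) (AlgebraicNumbers.0# ℚ̄)) where

  private
    K = AlgebraicNumbers.commutativeRing ℚ̄
    module K = CommutativeRing K
    module ℝ = CommutativeRing (RealNumbers.commutativeRing ℝ)
    ℂ = complexNumbers ℝ
    module ℂ = CommutativeRing ℂ
    module ℚ̄ = AlgebraicNumbers ℚ̄
    module ·ℝ = RawMonoidDefinitions ℝ.+-rawMonoid
    module ·ℂ = RawMonoidDefinitions ℂ.+-rawMonoid
    module ·K = RawMonoidDefinitions K.+-rawMonoid
  open ℚ̄ using (embed)
  open RingMorphisms.IsRingMonomorphism ℚ̄.monomorphism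
    using (injective; ⟦⟧-cong; +-homo; *-homo; -‿homo; 0#-homo; 1#-homo)
  open MetricGroup G
  open SquareRoot √N
  open FiniteGroup abelianGroup enumeration
  open UnitProperties ℂ
  module ∑K = FiniteSetoid.RingSummation enumeration K
  open SetoidReasoning ℂ.setoid

  formℂ : QuadraticForm ℂ abelianGroup
  formℂ = record
    { a = ⟨_⟩ ; a⁻¹ = ⟨_⟩⁻¹ ; b = ⟨_⨾_⟩
    ; a-inverse = a-inverse ; a-cong = ⟨⟩-cong ; a-even = ⟨⟩-even
    ; a-∙ = λ x y → polarization _ (a-inverse x) (a-inverse y)
    ; b-homoˡ = ⟨⨾⟩-homoˡ ; b-homoʳ = ⟨⨾⟩-homoʳ
    }
    where
    a-inverse : ∀ x → ⟨ x ⟩ ℂ.* ⟨ x ⟩⁻¹ ℂ.≈ ℂ.1#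
    a-inverse x = UnitOf.isInverse (unit x)

  pull : ∀ {x y z} → embed x ℂ.≈ z → embed y ℂ.≈ z → x K.≈ y
  pull x≈z y≈z = injective (ℂ.trans x≈z (ℂ.sym y≈z))

  1≉0-ℂ : ¬ ℂ.1# ℂ.≈ ℂ.0#
  1≉0-ℂ 1≈0 = 1≉0 (pull (ℂ.trans 1#-homo 1≈0) 0#-homo)

  -- `root-algebraic` and `integral-root` take successors; the order is one because `ε` has an
  -- index.
  order≡suc : ∃[ m ] order ≡ ℕ.suc m
  order≡suc = nonempty (Inverse.from enumeration ε)
    where
    nonempty : ∀ {n} → Fin n → ∃[ m ] n ≡ ℕ.suc m
    nonempty {ℕ.suc m} _ = m , ≡.refl

  2order≡suc : ∃[ m ] order ℕ.+ order ≡ ℕ.suc m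
  2order≡suc with order | order≡suc
  ... | .(ℕ.suc m) | m , ≡.refl = m ℕ.+ ℕ.suc m , ≡.refl

  opaque
    ⟨⟩-lift : ∀ x → ∃[ y ] embed y ℂ.≈ ⟨ x ⟩
    ⟨⟩-lift x = ℚ̄.surjective ⟨ x ⟩ (RootAlgebraic.root-algebraic ℂ (proj₁ 2order≡suc) 0 (ℂ.trans
      (≡.subst (λ m → ⟨ x ⟩ ^ m ℂ.≈ ℂ.1#) (proj₂ 2order≡suc)
        (QuadraticFormProperties.a-root-of-unity formℂ order (lagrange x)))
      (ℂ.sym (ℂ.+-identityʳ ℂ.1#))))
      where open Exponentiation ℂ.commutativeSemiring using (_^_)

  √N∈ℂ √N⁻¹∈ℂ : ℂ.Carrier
  √N∈ℂ   = root , ℝ.0#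
  √N⁻¹∈ℂ = root⁻¹ , ℝ.0#

  real-* : ∀ x y → (x , ℝ.0#) ℂ.* (y , ℝ.0#) ℂ.≈ (x ℝ.* y , ℝ.0#)
  real-* x y =
      ℝ.trans (ℝ.+-congˡ (ℝ.trans (ℝ.-‿cong (ℝ.zeroˡ ℝ.0#)) (RingProperties.-0#≈0# ℝ.ring))) (ℝ.+-identityʳ _)
    , ℝ.trans (ℝ.+-cong (ℝ.zeroʳ x) (ℝ.zeroˡ y)) (ℝ.+-identityˡ ℝ.0#)

  real-· : ∀ m → m ·ℂ.× ℂ.1# ℂ.≈ (m ·ℝ.× ℝ.1# , ℝ.0#)
  real-· ℕ.zero    = ℂ.refl
  real-· (ℕ.suc m) = ℂ.trans (ℂ.+-congˡ (real-· m)) (ℝ.refl , ℝ.+-identityˡ ℝ.0#)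

  √N*√N≈N : √N∈ℂ ℂ.* √N∈ℂ ℂ.≈ order ·ℂ.× ℂ.1#
  √N*√N≈N = ℂ.trans (real-* root root) (ℂ.trans (squared , ℝ.refl) (ℂ.sym (real-· order)))

  √N*√N⁻¹≈1 : √N∈ℂ ℂ.* √N⁻¹∈ℂ ℂ.≈ ℂ.1#
  √N*√N⁻¹≈1 = ℂ.trans (real-* root root⁻¹) (root*root⁻¹≈1 , ℝ.refl)
    where
    open RingProperties ℝ.ring using (-‿distribˡ-*; -‿distribʳ-*)
    inv = RealNumbers.#⇒invertible ℝ 0#root

    root*root⁻¹≈1 : root ℝ.* root⁻¹ ℝ.≈ ℝ.1#
    root*root⁻¹≈1 = ℝ.trans (ℝ.sym (-‿distribʳ-* root (proj₁ inv))) (ℝ.trans (-‿distribˡ-* root (proj₁ inv))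
      (ℝ.trans (ℝ.*-congʳ (ℝ.sym (ℝ.+-identityˡ (ℝ.- root)))) (proj₂ (proj₂ inv))))

  opaque
    √N-lift : ∃[ y ] embed y ℂ.≈ √N∈ℂ
    √N-lift = ℚ̄.surjective √N∈ℂ (RootAlgebraic.root-algebraic ℂ 1 (proj₁ order≡suc)
      (≡.subst (λ m → √N∈ℂ ℂ.* (√N∈ℂ ℂ.* ℂ.1#) ℂ.≈ m ·ℂ.× ℂ.1#) (proj₂ order≡suc)
        (ℂ.trans (ℂ.*-congˡ (ℂ.*-identityʳ √N∈ℂ)) √N*√N≈N)))

  a : Carrier → K.Carrier
  a x = proj₁ (⟨⟩-lift x)

  embed-a : ∀ x → embed (a x) ℂ.≈ ⟨ x ⟩
  embed-a x = proj₂ (⟨⟩-lift x)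

  s : K.Carrier
  s = proj₁ √N-lift

  embed-s : embed s ℂ.≈ √N∈ℂ
  embed-s = proj₂ √N-lift

  unit-embed⇒≉0 : ∀ {x u u⁻¹} → embed x ℂ.≈ u → u ℂ.* u⁻¹ ℂ.≈ ℂ.1# → ¬ x K.≈ K.0#
  unit-embed⇒≉0 {x} {u} {u⁻¹} x≈u inv x≈0 = 1≉0-ℂ (begin
    ℂ.1#                  ≈⟨ inv ⟨
    u ℂ.* u⁻¹             ≈⟨ ℂ.*-congʳ (ℂ.trans (ℂ.sym x≈u) (ℂ.trans (⟦⟧-cong x≈0) 0#-homo)) ⟩
    ℂ.0# ℂ.* u⁻¹          ≈⟨ ℂ.zeroˡ _ ⟩
    ℂ.0#                  ∎)

  opaque
    a-inverse-exists : ∀ x → ∃[ y ] a x K.* y K.≈ K.1#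
    a-inverse-exists x = ℚ̄.inverse (a x) (unit-embed⇒≉0 (embed-a x) (UnitOf.isInverse (unit x)))

  a⁻¹ : Carrier → K.Carrier
  a⁻¹ x = proj₁ (a-inverse-exists x)

  a-inverse : ∀ x → a x K.* a⁻¹ x K.≈ K.1#
  a-inverse x = proj₂ (a-inverse-exists x)

  embed-a⁻¹ : ∀ x → embed (a⁻¹ x) ℂ.≈ ⟨ x ⟩⁻¹
  embed-a⁻¹ x = unit-cancelˡ (UnitOf.isInverse (unit x)) (begin
    ⟨ x ⟩ ℂ.* embed (a⁻¹ x)          ≈⟨ ℂ.*-congʳ (embed-a x) ⟨
    embed (a x) ℂ.* embed (a⁻¹ x)    ≈⟨ *-homo _ _ ⟨
    embed (a x K.* a⁻¹ x)            ≈⟨ ℂ.trans (⟦⟧-cong (a-inverse x)) 1#-homo ⟩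
    ℂ.1#                             ≈⟨ UnitOf.isInverse (unit x) ⟨
    ⟨ x ⟩ ℂ.* ⟨ x ⟩⁻¹                ∎)

  embed-* : ∀ {x y z w} → embed x ℂ.≈ z → embed y ℂ.≈ w → embed (x K.* y) ℂ.≈ z ℂ.* w
  embed-* p q = ℂ.trans (*-homo _ _) (ℂ.*-cong p q)

  embed-+ : ∀ {x y z w} → embed x ℂ.≈ z → embed y ℂ.≈ w → embed (x K.+ y) ℂ.≈ z ℂ.+ w
  embed-+ p q = ℂ.trans (+-homo _ _) (ℂ.+-cong p q)

  b : Carrier → Carrier → K.Carrier
  b x y = a (x ∙ y) K.* (a⁻¹ x K.* a⁻¹ y)

  embed-b : ∀ x y → embed (b x y) ℂ.≈ ⟨ x ⨾ y ⟩
  embed-b x y = embed-* (embed-a _) (embed-* (embed-a⁻¹ x) (embed-a⁻¹ y))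

  form : QuadraticForm K abelianGroup
  form = record
    { a = a ; a⁻¹ = a⁻¹ ; b = b
    ; a-inverse = a-inverse
    ; a-cong = λ x≈y → pull (embed-a _) (ℂ.trans (embed-a _) (⟨⟩-cong (sym x≈y)))
    ; a-even = λ x → pull (embed-a x) (ℂ.trans (embed-a _) (ℂ.sym (⟨⟩-even x)))
    ; a-∙ = λ x y → UnitProperties.polarization K _ (a-inverse x) (a-inverse y)
    ; b-homoˡ = λ x y z → pull (embed-b _ _)
        (ℂ.trans (embed-* (embed-b _ _) (embed-b _ _)) (ℂ.sym (⟨⨾⟩-homoˡ x y z)))
    ; b-homoʳ = λ x y z → pull (embed-b _ _)
        (ℂ.trans (embed-* (embed-b _ _) (embed-b _ _)) (ℂ.sym (⟨⨾⟩-homoʳ x y z)))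
    }

  embed-∑ : ∀ {f f′} → (∀ x → embed (f x) ℂ.≈ f′ x) → embed (∑K.∑ f) ℂ.≈ ∑ f′
  embed-∑ {f} {f′} f≈f′ = ℂ.trans (⟦⟧-cong (∑K.∑-sum f)) (embed-sum (f≈f′ ∘ Inverse.to enumeration))
    where
    embed-sum : ∀ {m} {f : Vector K.Carrier m} {f′} → (∀ i → embed (f i) ℂ.≈ f′ i) →
                embed (·K.sum f) ℂ.≈ ·ℂ.sum f′
    embed-sum {ℕ.zero}  f≈f′ = 0#-homo
    embed-sum {ℕ.suc m} f≈f′ = embed-+ (f≈f′ zero) (embed-sum (f≈f′ ∘ suc))

  embed-· : ∀ m → embed (m ·K.× K.1#) ℂ.≈ m ·ℂ.× ℂ.1#
  embed-· ℕ.zero    = 0#-homo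
  embed-· (ℕ.suc m) = embed-+ 1#-homo (embed-· m)

  open IsFiniteQuantumDilogarithm dilog using (dilogarithm)
    renaming (E-cong to embedE-cong; small-order to small)

  C : ℂ.Carrier
  C = proj₁ dilogarithm

  lhs rhs : Carrier → Carrier → K.Carrier
  lhs x y = s K.* (b x y K.* E x K.* E y)
  rhs x y = ∑K.∑ (λ z → E (y - z) K.* E z K.* a z K.* E (x - z))

  embed-dilogarithm : ∀ x y → embed (lhs x y) ℂ.≈ √N∈ℂ ℂ.* C ℂ.+ embed (rhs x y)
  embed-dilogarithm x y = begin
    embed (lhs x y)
      ≈⟨ embed-* embed-s (embed-* (embed-* (embed-b x y) ℂ.refl) ℂ.refl) ⟩
    √N∈ℂ ℂ.* (⟨ x ⨾ y ⟩ ℂ.* embed (E x) ℂ.* embed (E y))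
      ≈⟨ ℂ.*-congˡ (proj₂ (proj₂ dilogarithm) x y) ⟩
    √N∈ℂ ℂ.* (C ℂ.+ √N⁻¹∈ℂ ℂ.* R)
      ≈⟨ ℂ.distribˡ _ _ _ ⟩
    √N∈ℂ ℂ.* C ℂ.+ √N∈ℂ ℂ.* (√N⁻¹∈ℂ ℂ.* R)
      ≈⟨ ℂ.+-congˡ (ℂ.trans (ℂ.sym (ℂ.*-assoc _ _ _))
           (ℂ.trans (ℂ.*-congʳ √N*√N⁻¹≈1) (ℂ.*-identityˡ R))) ⟩
    √N∈ℂ ℂ.* C ℂ.+ R
      ≈⟨ ℂ.+-congˡ (embed-∑ λ z → embed-* (embed-* (embed-* ℂ.refl ℂ.refl) (embed-a z)) ℂ.refl) ⟨
    √N∈ℂ ℂ.* C ℂ.+ embed (rhs x y) ∎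
    where
    R = ∑ (λ z → embed (E (y ∙ z ⁻¹)) ℂ.* embed (E z) ℂ.* ⟨ z ⟩ ℂ.* embed (E (x ∙ z ⁻¹)))

  -- C is given only in ℂ. The defining equation at (0, 0) expresses √N C through elements of ℚ̄,
  -- which provides its preimage directly.
  c′ : K.Carrier
  c′ = lhs ε ε K.- rhs ε ε

  embed-c : embed c′ ℂ.≈ √N∈ℂ ℂ.* C
  embed-c = begin
    embed (lhs ε ε K.- rhs ε ε)
      ≈⟨ embed-+ (embed-dilogarithm ε ε) (-‿homo _) ⟩
    √N∈ℂ ℂ.* C ℂ.+ embed (rhs ε ε) ℂ.- embed (rhs ε ε)
      ≈⟨ ℂ.trans (ℂ.+-assoc _ _ _) (ℂ.+-congˡ (ℂ.-‿inverseʳ _)) ⟩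
    √N∈ℂ ℂ.* C ℂ.+ ℂ.0#
      ≈⟨ ℂ.+-identityʳ _ ⟩
    √N∈ℂ ℂ.* C ∎

  fieldDilogarithm : FieldDilogarithm K abelianGroup order
  fieldDilogarithm = record
    { ≈0? = ≈0? ; 1≉0 = 1≉0 ; inverse = ℚ̄.inverse
    ; enumeration = enumeration ; odd = odd⇒no-2-torsion 2∤N
    ; form = form
    ; nondegenerate = λ x b≈1 → nondegenerate x λ y →
        ℂ.trans (ℂ.sym (embed-b x y)) (ℂ.trans (⟦⟧-cong (b≈1 y)) 1#-homo)
    ; s = s ; c = c′
    ; s≉0 = unit-embed⇒≉0 embed-s √N*√N⁻¹≈1
    ; s²≈n = pull (embed-* embed-s embed-s) (ℂ.trans (embed-· order) (ℂ.sym √N*√N≈N))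
    ; c≉0 = λ c≈0 → proj₁ (proj₂ dilogarithm) (unit-cancelˡ √N*√N⁻¹≈1 (begin
        √N∈ℂ ℂ.* C       ≈⟨ embed-c ⟨
        embed c′         ≈⟨ ℂ.trans (⟦⟧-cong c≈0) 0#-homo ⟩
        ℂ.0#             ≈⟨ ℂ.zeroʳ _ ⟨
        √N∈ℂ ℂ.* ℂ.0#    ∎))
    ; E = E
    ; E-cong = λ x≈y → injective (embedE-cong x≈y)
    ; dilogarithm = λ x y → pull (embed-dilogarithm x y) (embed-+ embed-c ℂ.refl)
    ; small-order = λ n≤4 → injective (ℂ.trans (*-homo _ _) (ℂ.trans (small n≤4)
        (ℂ.sym (embed-+ (embed-* embed-s ℂ.refl) 1#-homo))))
    }

theorem10 : ∀ {c ℓ₁ ℓ₂ d ℓ g ℓg γ ℓγ₁ ℓγ₂}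
    (ℝ : RealNumbers c ℓ₁ ℓ₂) (ℚ̄ : AlgebraicNumbers ℝ d ℓ)
    (G : MetricGroup ℝ g ℓg) → ¬ (2 ∣ MetricGroup.order G) →
    (√N : SquareRoot ℝ (MetricGroup.order G)) →
    (E : MetricGroup.Carrier G → AlgebraicNumbers.Carrier ℚ̄) →
    IsFiniteQuantumDilogarithm G √N (AlgebraicNumbers.embed ℚ̄ ∘ E) →
    (Γ : OrderedAbelianGroup γ ℓγ₁ ℓγ₂) (V : Valuation (AlgebraicNumbers.commutativeRing ℚ̄) Γ) →
    ExtendsTwoAdic V →
    ∀ u → OrderedAbelianGroup._≈⁺_ Γ (Valuation.v V (E u)) [ OrderedAbelianGroup.ε Γ ]
theorem10 ℝ ℚ̄ G 2∤N √N E dilog Γ V extends =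
  Integrality.v-E fieldDilogarithm extends integral-a integral-s
  where
  open ValuationProperties extends
  open Descent ℚ̄ G 2∤N √N E dilog ≈0? 1≉0
  open MetricGroup G using (order; abelianGroup; enumeration)
  open FiniteGroup abelianGroup enumeration using (lagrange)
  open FieldDilogarithm fieldDilogarithm using (s²≈n)
  open CommutativeRing (AlgebraicNumbers.commutativeRing ℚ̄)
  open Exponentiation commutativeSemiring using (_^_)
  open RawMonoidDefinitions +-rawMonoid using () renaming (_×_ to _·_)

  -- Roots of unity are integral, and so is `s`, as a square root of the integer N.
  integral-a : ∀ x → Integral (a x)
  integral-a x = integral-root (AlgebraicNumbers.inverse ℚ̄) (proj₁ 2order≡suc)
    (integral-cong (sym (≡.subst (λ m → a x ^ m ≈ 1#) (proj₂ 2order≡suc)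
      (QuadraticFormProperties.a-root-of-unity form order (lagrange x)))) integral-1)

  integral-· : ∀ m → Integral (m · 1#)
  integral-· ℕ.zero    = integral-0
  integral-· (ℕ.suc m) = integral-+ integral-1 (integral-· m)

  integral-s : Integral s
  integral-s = integral-root (AlgebraicNumbers.inverse ℚ̄) 1
    (integral-cong (trans (sym s²≈n) (*-congˡ (sym (*-identityʳ s)))) (integral-· order))
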